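{- As $n \to \infty$ over the positive integers, $q(n) \leq (1+o(1)) \frac{e \ln 2}{8} n^2$.
   Context: A hypergraph $H=(V,E)$ is a finite vertex set $V$ together with a set $E$ of edges, each edge being a subset of $V$ with at least two vertices. A 2-colouring of $H$ assigns one of two colours to each vertex; it is proper if no edge is monochromatic, and $H$ is 2-colourable if it has a proper 2-colouring. For a hypergraph $H=(V,E)$ define $q(H) = \sum_{e\in E} 2^{ -|e|}$. For a positive integer $n$, $q(n)$ denotes the minimum of $q(H)$ over all hypergraphs $H$ that are not 2-colourable and whose smallest edge has exactly $n$ vertices. Here $e$ is Euler's number and $\ln$ is the natural logarithm. -}

module Defs where

open import Algebra.Definitions.RawSemiring using (_^_)
open import Data.Bool.Base using (Bool)
open import Data.Fin.Base using (Fin)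
open import Data.Fin.Subset using (Subset; ∣_∣) renaming (_∈_ to _∈ₛ_)
open import Data.Integer.Base using (+_)
open import Data.List.Base using (List; map; foldr; upTo)
open import Data.List.Relation.Unary.All using (All)
open import Data.List.Relation.Unary.Any using (Any)
open import Data.List.Relation.Unary.Unique.Propositional using (Unique)
open import Data.Nat.Base as ℕ using (ℕ; _!)
open import Data.Nat.Properties using (_!≢0)
open import Data.Product using (∃-syntax; _×_; _,_)
open import Data.Rational.Base
  using (ℚ; 0ℚ; 1ℚ; ½; _/_; _<_; _≤_; _+_; _*_; +-*-rawSemiring)
open import Data.Rational.Properties
  using (<-dense; <-trans; ≤-<-trans)
open import Relation.Binary.PropositionalEquality using (_≡_)
open import Relation.Nullary using (¬_)

record Hypergraph : Set where
  field
    order    : ℕ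
    edges    : List (Subset order)
    distinct : Unique edges
    nontriv  : All (λ e → 2 ℕ.≤ ∣ e ∣) edges

open Hypergraph public

Colouring : Hypergraph → Set
Colouring H = Fin (order H) → Bool

Monochromatic : (H : Hypergraph) → Colouring H → Subset (order H) → Set
Monochromatic H c e = ∃[ b ] (∀ v → v ∈ₛ e → c v ≡ b)

Proper : (H : Hypergraph) → Colouring H → Set
Proper H c = All (λ e → ¬ Monochromatic H c e) (edges H)

TwoColourable : Hypergraph → Set
TwoColourable H = ∃[ c ] Proper H c

SmallestEdge : Hypergraph → ℕ → Set
SmallestEdge H n = Any (λ e → ∣ e ∣ ≡ n) (edges H) × All (λ e → n ℕ.≤ ∣ e ∣) (edges H)

pow : ℚ → ℕ → ℚ
pow = _^_ +-*-rawSemiring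

sumℚ : List ℚ → ℚ
sumℚ = foldr _+_ 0ℚ

weight : Hypergraph → ℚ
weight H = sumℚ (map (λ e → pow ½ ∣ e ∣) (edges H))

-- Extended nonnegative reals, [0,∞], as upper Dedekind cuts.
--
-- x is given by the rationals strictly above it.  Classically these cuts are
-- exactly the elements of [0,∞] (the empty cut being ∞).  Unlike two-sided
-- cuts or Cauchy reals, they have all infima constructively.

record ℝ⁺ : Set₁ where
  field
    _<ʳ_    : ℚ → Set
    nonneg  : ∀ {s} → _<ʳ_ s → 0ℚ < s
    upward  : ∀ {s t} → _<ʳ_ s → s < t → _<ʳ_ t
    rounded : ∀ {s} → _<ʳ_ s → ∃[ r ] (_<ʳ_ r × r < s)

open ℝ⁺ public using () renaming (_<ʳ_ to _<ʳ_)

infix 4 _≤ʳ_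
infixl 7 _*ʳ_

_≤ʳ_ : ℝ⁺ → ℝ⁺ → Set
x ≤ʳ y = ∀ s → y <ʳ s → x <ʳ s

-- The infimum in [0,∞] of the nonnegative rationals satisfying P.
inf : (ℚ → Set) → ℝ⁺
inf P = record
  { _<ʳ_    = λ s → ∃[ r ] (0ℚ ≤ r × P r × r < s)
  ; nonneg  = λ (_ , 0≤r , _ , r<s) → ≤-<-trans 0≤r r<s
  ; upward  = λ (r , 0≤r , p , r<s) s<t → r , 0≤r , p , <-trans r<s s<t
  ; rounded = λ (r , 0≤r , p , r<s) →
      let (m , r<m , m<s) = <-dense r<s in m , (r , 0≤r , p , r<m) , m<s
  }

-- For r ≥ 0.
fromℚ : ℚ → ℝ⁺
fromℚ r = inf (λ t → r ≤ t)

fromℕ : ℕ → ℝ⁺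
fromℕ n = fromℚ (+ n / 1)

-- Here 0 · ∞ = ∞; on finite elements this is ordinary multiplication.
_*ʳ_ : ℝ⁺ → ℝ⁺ → ℝ⁺
x *ʳ y = inf (λ t → ∃[ a ] ∃[ b ] (x <ʳ a × y <ʳ b × t ≡ a * b))

expTerm : ℚ → ℕ → ℚ
expTerm r k = pow r k * (_/_ (+ 1) (k !) {{k !≢0}})

expSum : ℚ → ℕ → ℚ
expSum r N = sumℚ (map (expTerm r) (upTo N))

-- For r ≥ 0 the partial sums increase, so the sum of the exponential series is
-- their least upper bound.
exp : ℚ → ℝ⁺
exp r = inf (λ t → ∀ N → expSum r N ≤ t)

e : ℝ⁺
e = exp 1ℚ

-- For y ≥ 1: ln is the inverse of the increasing function exp on [0,∞).
ln : ℚ → ℝ⁺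
ln y = inf (λ r → fromℚ y ≤ʳ exp r)

Attains : ℕ → ℚ → Set
Attains n r = ∃[ H ] (¬ TwoColourable H × SmallestEdge H n × weight H ≡ r)

q : ℕ → ℝ⁺
q n = inf (Attains n)

-- By inf-minimum, `q n` is the minimum of the attained weights whenever there
-- is one.  For n = 1 no weight is attained and q n is ∞.
IsMinimum : (ℚ → Set) → ℚ → Set
IsMinimum P r = P r × (∀ t → P t → r ≤ t)

inf-minimum : ∀ P r → 0ℚ ≤ r → IsMinimum P r → (inf P ≤ʳ fromℚ r) × (fromℚ r ≤ʳ inf P)
inf-minimum P r 0≤r (Pr , min) =
  (λ s (t , _ , r≤t , t<s) → r , 0≤r , Pr , ≤-<-trans r≤t t<s) ,
  (λ s (t , 0≤t , Pt , t<s) → t , 0≤t , min t Pt , t<s)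

{-# OPTIONS --safe #-}

-- Take v = 2h vertices with h ≈ n²/4 + n.  Every 2-colouring makes at least a fraction
-- x ≈ 2^(1-n)/e of the n-subsets monochromatic (balanced colourings are the worst case, by
-- convexity of binomial coefficients), so greedily chosen n-subsets leave at most 2^v (1-x)^m
-- colourings after m steps.  Instead of continuing until no colouring is left, stop when 2^h are
-- left, at m ≈ h ln 2 / x, and add for each of them its larger colour class as an edge.  These
-- classes have at least h vertices, so they weigh at most 1 in total; stopping at 2^h rather than
-- at 1 is what halves Erdős's bound (e ln 2 / 4) n².

module Submission where

open import Defs
open import Algebra.Bundles using (CommutativeRing)
open import Data.Bool.Base using (Bool; true; false; not; _∧_; _∨_)
import Data.Bool.Properties as Boolₚ
open import Data.Empty using (⊥)
open import Data.Fin.Base using () renaming (zero to fzero; suc to fsuc)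
open import Data.Fin.Subset using (Subset; inside; outside; ∣_∣) renaming (_∈_ to _∈ₛ_)
open import Data.List.Base
  using (List; []; _∷_; map; _++_; _∷ʳ_; length; upTo; deduplicate; filter; filterᵇ)
import Data.List.Properties as Listₚ
open import Data.List.Membership.Propositional using (_∈_)
import Data.List.Membership.Propositional.Properties as ∈ₚ
open import Data.List.Relation.Unary.All as All using (All; []; _∷_)
import Data.List.Relation.Unary.All.Properties as Allₚ
open import Data.List.Relation.Unary.Any as Any using (Any; here; there)
import Data.List.Relation.Unary.Any.Properties as Anyₚ
import Data.List.Relation.Unary.Unique.DecPropositional.Properties as Uniqueₚ
open import Data.Nat.Base as ℕ using (ℕ; zero; suc; z≤n; s≤s; _!)
import Data.Nat.DivMod as ℕ
import Data.Nat.Properties as ℕₚ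
open import Data.Product using (∃-syntax; _×_; _,_; proj₁; proj₂)
open import Data.Sum.Base as Sum using (_⊎_; inj₁; inj₂)
open import Data.Vec.Base as Vec using (Vec; []; _∷_)
import Data.Vec.Properties as Vecₚ
open import Relation.Binary.PropositionalEquality
open import Relation.Nullary using (¬_; does; contradiction)
open import Relation.Nullary.Decidable using (from-yes)
open import Relation.Unary using (Decidable)

-- The value of h comes from an optimisation. Since C(2h,n)/C(h,n) is about 2^n exp(n²/4h), the
-- chosen n-subsets weigh about (h ln 2 / 2) exp(n²/4h) in total. This is least at h = n²/4, where
-- the exponential equals e. The extra n in h keeps h - k above n²/4 for every k < n. Each factor of
-- the binomial ratio can then be bounded exactly, at a cost linear in n.
--
-- The reals of the statement are upper cuts, so a rational above the right-hand side yields only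
-- rationals above e and ln 2. The construction therefore uses just two of them: `e₁`, which bounds
-- all partial sums of e, and `l`, for which exp l is at least 2. Facts about exp become
-- inequalities between partial sums, and powers of 1 - x replace exponentials of negative numbers.
--
-- The threshold on n has to be fixed before `e₁` and `l` are known. All lower-order terms are
-- therefore compared with `l * e₁` uniformly, which the crude bound l ≥ 1/2 makes possible.

module Counting where

  -- Counting monochromatic subsets; convexity of binomial coefficients.

  open import Data.Nat.Base using (_+_; _*_; _∸_; _≤_)
  open import Data.Nat.Properties
  open import Data.Nat.Solver using (module +-*-Solver)

  -- Unlike Data.Nat.Combinatorics._C_, this satisfies Pascal's rule definitionally.
  binom : ℕ → ℕ → ℕ
  binom _       zero    = 1
  binom zero    (suc _) = 0
  binom (suc n) (suc k) = binom n k + binom n (suc k)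

  k-subsets : ∀ v (k : ℕ) → List (Subset v)
  k-subsets zero    zero    = [] ∷ []
  k-subsets zero    (suc _) = []
  k-subsets (suc v) zero    = map (outside ∷_) (k-subsets v zero)
  k-subsets (suc v) (suc k) = map (inside ∷_) (k-subsets v k) ++ map (outside ∷_) (k-subsets v (suc k))

  length-k-subsets : ∀ v k → length (k-subsets v k) ≡ binom v k
  length-k-subsets zero    zero    = refl
  length-k-subsets zero    (suc k) = refl
  length-k-subsets (suc v) zero    = trans (Listₚ.length-map (outside ∷_) (k-subsets v zero)) (length-k-subsets v zero)
  length-k-subsets (suc v) (suc k) = trans (Listₚ.length-++ (map (inside ∷_) (k-subsets v k)))
    (cong₂ _+_ (trans (Listₚ.length-map (inside ∷_) (k-subsets v k)) (length-k-subsets v k))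
               (trans (Listₚ.length-map (outside ∷_) (k-subsets v (suc k))) (length-k-subsets v (suc k))))

  k-subsets-size : ∀ v (k : ℕ) → All (λ s → ∣ s ∣ ≡ k) (k-subsets v k)
  k-subsets-size zero    zero    = refl ∷ []
  k-subsets-size zero    (suc k) = []
  k-subsets-size (suc v) zero    = Allₚ.map⁺ (k-subsets-size v zero)
  k-subsets-size (suc v) (suc k) =
    Allₚ.++⁺ (Allₚ.map⁺ (All.map (cong suc) (k-subsets-size v k))) (Allₚ.map⁺ (k-subsets-size v (suc k)))

  ⟦_⟧ : Bool → ℕ
  ⟦ true ⟧  = 1
  ⟦ false ⟧ = 0

  _==_ : Bool → Bool → Bool
  true  == b = b
  false == b = not b

  fits : ∀ {v} → Bool → Vec Bool v → Subset v → Bool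
  fits b []      []            = true
  fits b (x ∷ c) (outside ∷ s) = fits b c s
  fits b (x ∷ c) (inside ∷ s)  = (b == x) ∧ fits b c s

  class : ∀ {v} → Bool → Vec Bool v → Subset v
  class b = Vec.map (b ==_)

  total : ∀ {A : Set} → (A → ℕ) → List A → ℕ
  total f []       = 0
  total f (x ∷ xs) = f x + total f xs

  total-++ : ∀ {A : Set} (f : A → ℕ) xs ys → total f (xs ++ ys) ≡ total f xs + total f ys
  total-++ f []       ys = refl
  total-++ f (x ∷ xs) ys = trans (cong (f x +_) (total-++ f xs ys)) (sym (+-assoc (f x) _ _))

  total-map : ∀ {A B : Set} (f : B → ℕ) (g : A → B) xs → total f (map g xs) ≡ total (λ x → f (g x)) xs
  total-map f g []       = refl
  total-map f g (x ∷ xs) = cong (f (g x) +_) (total-map f g xs)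

  total-zero : ∀ {A : Set} (xs : List A) → total (λ _ → 0) xs ≡ 0
  total-zero []       = refl
  total-zero (_ ∷ xs) = total-zero xs

  total-+ : ∀ {A : Set} (f g : A → ℕ) xs → total (λ x → f x + g x) xs ≡ total f xs + total g xs
  total-+ f g []       = refl
  total-+ f g (x ∷ xs) = trans (cong (f x + g x +_) (total-+ f g xs))
    (+-*-Solver.solve 4 (λ a b c d → (a :+ b) :+ (c :+ d) := (a :+ c) :+ (b :+ d))
        refl (f x) (g x) (total f xs) (total g xs))
    where open +-*-Solver using (_:+_; _:=_)

  total-swap : ∀ {A B : Set} (f : A → B → ℕ) xs ys →
    total (λ x → total (f x) ys) xs ≡ total (λ y → total (λ x → f x y) xs) ys
  total-swap f []       ys = sym (total-zero ys)
  total-swap f (x ∷ xs) ys = trans (cong (total (f x) ys +_) (total-swap f xs ys))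
    (sym (total-+ (f x) (λ y → total (λ x → f x y) xs) ys))

  total-mono : ∀ {A : Set} {f g : A → ℕ} {xs} → All (λ x → f x ≤ g x) xs → total f xs ≤ total g xs
  total-mono []         = z≤n
  total-mono (fx≤gx ∷ ps) = +-mono-≤ fx≤gx (total-mono ps)

  total-≥ : ∀ {A : Set} {f : A → ℕ} {k} → (∀ x → k ≤ f x) → ∀ xs → length xs * k ≤ total f xs
  total-≥ k≤f []       = z≤n
  total-≥ k≤f (x ∷ xs) = +-mono-≤ (k≤f x) (total-≥ k≤f xs)

  -- The witness is a maximiser of `f`. Multiplying by the length keeps the averaging argument free
  -- of division.
  average : ∀ {A : Set} (f : A → ℕ) x xs → ∃[ y ] (y ∈ x ∷ xs × total f (x ∷ xs) ≤ length (x ∷ xs) * f y)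
  average f x []        = x , here refl , ≤-refl
  average f x (x′ ∷ xs) with average f x′ xs
  ... | y , y∈ , avg with ≤-total (f x) (f y)
  ...   | inj₁ fx≤fy = y , there y∈ , +-mono-≤ fx≤fy avg
  ...   | inj₂ fy≤fx = x , here refl , +-monoʳ-≤ (f x) (≤-trans avg (*-monoʳ-≤ (length (x′ ∷ xs)) fy≤fx))

  -- A set fits colour `b` exactly when it lies inside the class of `b`. Vertices outside the class
  -- contribute nothing, and each vertex inside it is one use of Pascal's rule.
  fitting≡binom : ∀ {v} b (c : Vec Bool v) k → total (λ s → ⟦ fits b c s ⟧) (k-subsets v k) ≡ binom ∣ class b c ∣ k
  fitting≡binom b []      zero    = refl
  fitting≡binom b []      (suc k) = refl
  fitting≡binom {suc v} b (x ∷ c) zero =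
    trans (total-map _ (outside ∷_) (k-subsets v zero)) (fitting≡binom b c zero)
  fitting≡binom {suc v} b (x ∷ c) (suc k) = begin
    total (λ s → ⟦ fits b (x ∷ c) s ⟧) (k-subsets (suc v) (suc k))
      ≡⟨ total-++ _ (map (inside ∷_) (k-subsets v k)) (map (outside ∷_) (k-subsets v (suc k))) ⟩
    _
      ≡⟨ cong₂ _+_ (total-map _ (inside ∷_) (k-subsets v k)) (total-map _ (outside ∷_) (k-subsets v (suc k))) ⟩
    total (λ s → ⟦ (b == x) ∧ fits b c s ⟧) (k-subsets v k) + total (λ s → ⟦ fits b c s ⟧) (k-subsets v (suc k))
      ≡⟨ head (b == x) ⟩
    binom ∣ class b (x ∷ c) ∣ (suc k) ∎
    where
    open ≡-Reasoning
    head : ∀ y → total (λ s → ⟦ y ∧ fits b c s ⟧) (k-subsets v k) + total (λ s → ⟦ fits b c s ⟧) (k-subsets v (suc k))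
      ≡ binom ∣ y ∷ class b c ∣ (suc k)
    head true  = cong₂ _+_ (fitting≡binom b c k) (fitting≡binom b c (suc k))
    head false = cong₂ _+_ (total-zero (k-subsets v k)) (fitting≡binom b c (suc k))

  ∣classes∣ : ∀ {v} (c : Vec Bool v) → ∣ class true c ∣ + ∣ class false c ∣ ≡ v
  ∣classes∣ []          = refl
  ∣classes∣ (true  ∷ c) = cong suc (∣classes∣ c)
  ∣classes∣ (false ∷ c) = trans (+-suc _ _) (cong suc (∣classes∣ c))

  class-fits : ∀ {v} b (c : Vec Bool v) → fits b c (class b c) ≡ true
  class-fits b     []          = refl
  class-fits true  (true  ∷ c) = class-fits true c
  class-fits true  (false ∷ c) = class-fits true c
  class-fits false (true  ∷ c) = class-fits false c
  class-fits false (false ∷ c) = class-fits false c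

  fits⇒constant : ∀ {v} b (c : Vec Bool v) s → fits b c s ≡ true → ∀ i → i ∈ₛ s → Vec.lookup c i ≡ b
  fits⇒constant b     (x ∷ c)     (outside ∷ s) fit (fsuc i) (Vec.there i∈s) = fits⇒constant b c s fit i i∈s
  fits⇒constant true  (true ∷ c)  (inside ∷ s)  fit fzero    _               = refl
  fits⇒constant false (false ∷ c) (inside ∷ s)  fit fzero    _               = refl
  fits⇒constant true  (true ∷ c)  (inside ∷ s)  fit (fsuc i) (Vec.there i∈s) = fits⇒constant true c s fit i i∈s
  fits⇒constant false (false ∷ c) (inside ∷ s)  fit (fsuc i) (Vec.there i∈s) = fits⇒constant false c s fit i i∈s

  -- For a nonempty set at most one summand is 1, so this is the indicator of being monochromatic.
  -- Written as a sum, it splits over the two colour classes.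
  mono : ∀ {v} → Vec Bool v → Subset v → ℕ
  mono c s = ⟦ fits true c s ⟧ + ⟦ fits false c s ⟧

  fits-both : ∀ {v} (c : Vec Bool v) s → fits true c s ≡ true → fits false c s ≡ true → ∣ s ∣ ≡ 0
  fits-both []          []            _ _ = refl
  fits-both (x ∷ c)     (outside ∷ s) p q = fits-both c s p q
  fits-both (true ∷ c)  (inside ∷ s)  p ()
  fits-both (false ∷ c) (inside ∷ s)  () q

  binom-mono : ∀ {m n} k → m ≤ n → binom m k ≤ binom n k
  binom-mono zero    m≤n             = ≤-refl
  binom-mono (suc k) z≤n             = z≤n
  binom-mono (suc k) (s≤s m≤n) = +-mono-≤ (binom-mono k m≤n) (binom-mono (suc k) m≤n)

  -- By Pascal's rule the increments at `m` and `n` are binomials with lower index one less, so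
  -- convexity reduces to monotonicity in the upper index.
  binom-spread : ∀ {m n} k → m ≤ n → binom (suc m) k + binom n k ≤ binom m k + binom (suc n) k
  binom-spread         zero    m≤n = ≤-refl
  binom-spread {m} {n} (suc k) m≤n = begin
    (binom m k + binom m (suc k)) + binom n (suc k)
      ≤⟨ +-monoˡ-≤ _ (+-monoˡ-≤ _ (binom-mono k m≤n)) ⟩
    (binom n k + binom m (suc k)) + binom n (suc k)
      ≡⟨ cong (_+ binom n (suc k)) (+-comm (binom n k) _) ⟩
    (binom m (suc k) + binom n k) + binom n (suc k)    ≡⟨ +-assoc (binom m (suc k)) _ _ ⟩
    binom m (suc k) + (binom n k + binom n (suc k))    ∎
    where open ≤-Reasoning

  -- Two equal classes are pulled apart in `d` moves of one element, and no move lowers the sum.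
  binom-balanced : ∀ a d k → binom (d + a) k + binom (d + a) k ≤ binom a k + binom (d + (d + a)) k
  binom-balanced a zero    k = ≤-refl
  binom-balanced a (suc d) k = begin
    binom (suc d + a) k + binom (suc d + a) k
      ≡⟨ cong (λ z → binom z k + binom z k) (+-suc d a) ⟨
    binom (d + suc a) k + binom (d + suc a) k         ≤⟨ binom-balanced (suc a) d k ⟩
    binom (suc a) k + binom (d + (d + suc a)) k
      ≤⟨ binom-spread k (≤-trans (m≤n+m a (suc d)) (≤-trans (≤-reflexive (sym (+-suc d a))) (m≤n+m (d + suc a) d))) ⟩
    binom a k + binom (suc (d + (d + suc a))) k
      ≡⟨ cong (λ z → binom a k + binom (suc d + z) k) (+-suc d a) ⟩
    binom a k + binom (suc d + (suc d + a)) k         ∎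
    where open ≤-Reasoning

  binom-convex-≤ : ∀ {a b h} k → a ≤ h → a + b ≡ h + h → binom h k + binom h k ≤ binom a k + binom b k
  binom-convex-≤ {a} {b} {h} k a≤h a+b≡2h =
    subst₂ (λ y z → binom y k + binom y k ≤ binom a k + binom z k) d+a≡h d+d+a≡b (binom-balanced a d k)
    where
    d = h ∸ a
    d+a≡h : d + a ≡ h
    d+a≡h = m∸n+n≡m a≤h
    d+d+a≡b : d + (d + a) ≡ b
    d+d+a≡b = +-cancelˡ-≡ a _ _ (begin
      a + (d + (d + a))  ≡⟨ +-assoc a d (d + a) ⟨
      (a + d) + (d + a)  ≡⟨ cong₂ _+_ (m+[n∸m]≡n a≤h) d+a≡h ⟩
      h + h              ≡⟨ a+b≡2h ⟨
      a + b              ∎)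
      where open ≡-Reasoning

  binom-convex : ∀ {a b h} k → a + b ≡ h + h → binom h k + binom h k ≤ binom a k + binom b k
  binom-convex {a} {b} {h} k a+b≡2h with ≤-total a h
  ... | inj₁ a≤h = binom-convex-≤ k a≤h a+b≡2h
  ... | inj₂ h≤a = ≤-trans (binom-convex-≤ k b≤h (trans (+-comm b a) a+b≡2h)) (≤-reflexive (+-comm (binom b k) (binom a k)))
    where
    b≤h : b ≤ h
    b≤h = +-cancelˡ-≤ h b h (≤-trans (+-monoˡ-≤ b h≤a) (≤-reflexive a+b≡2h))

  mono-total : ∀ h (c : Vec Bool (h + h)) k → binom h k + binom h k ≤ total (mono c) (k-subsets (h + h) k)
  mono-total h c k = begin
    binom h k + binom h k                                  ≤⟨ binom-convex k (∣classes∣ c) ⟩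
    binom (∣ class true c ∣) k + binom (∣ class false c ∣) k
      ≡⟨ cong₂ _+_ (fitting≡binom true c k) (fitting≡binom false c k) ⟨
    _                                                      ≡⟨ total-+ _ _ (k-subsets (h + h) k) ⟨
    total (mono c) (k-subsets (h + h) k)                   ∎
    where open ≤-Reasoning

  -- This is (k+1) C(n,k+1) = (n-k) C(n,k) with the subtraction moved across. It gives the ratio of
  -- consecutive binomials, from which C(2h,n)/C(h,n) is bounded factor by factor.
  binom-absorb : ∀ n k → suc k * binom n (suc k) + k * binom n k ≡ n * binom n k
  binom-absorb zero    zero    = refl
  binom-absorb zero    (suc k) = cong₂ _+_ (*-zeroʳ (suc (suc k))) (*-zeroʳ (suc k))
  binom-absorb (suc n) zero    = begin
    1 * (1 + binom n 1) + 0
      ≡⟨ solve 1 (λ b → con 1 :* (con 1 :+ b) :+ con 0 := con 1 :+ (con 1 :* b :+ con 0))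
          refl (binom n 1) ⟩
    1 + (1 * binom n 1 + 0 * 1)      ≡⟨ cong suc (binom-absorb n zero) ⟩
    suc n * 1                              ∎
    where
    open ≡-Reasoning
    open +-*-Solver using (solve; _:+_; _:*_; _:=_; con)
  binom-absorb (suc n) (suc k) = begin
    suc (suc k) * (b + c) + suc k * (a + b)
      ≡⟨ solve 4 (λ k a b c → (con 2 :+ k) :* (b :+ c) :+ (con 1 :+ k) :* (a :+ b)
           := ((con 2 :+ k) :* c :+ (con 1 :+ k) :* b) :+ ((con 1 :+ k) :* b :+ k :* a) :+ (a :+ b)) refl k a b c ⟩
    (suc (suc k) * c + suc k * b) + (suc k * b + k * a) + (a + b)
      ≡⟨ cong₂ (λ y z → y + z + (a + b)) (binom-absorb n (suc k)) (binom-absorb n k) ⟩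
    n * b + n * a + (a + b)
      ≡⟨ solve 3 (λ n a b → n :* b :+ n :* a :+ (a :+ b) := (con 1 :+ n) :* (a :+ b)) refl n a b ⟩
    suc n * (a + b) ∎
    where
    open ≡-Reasoning
    open +-*-Solver using (solve; _:+_; _:*_; _:=_; con)
    a = binom n k
    b = binom n (suc k)
    c = binom n (suc (suc k))

open Counting

-- Naturals inside the rationals and ordered-field arithmetic.

open import Data.Integer.Base as ℤ using (+_)
import Data.Integer.Properties as ℤₚ
open import Data.Rational.Base
  using (ℚ; mkℚ; 0ℚ; 1ℚ; ½; _/_; _<_; _≤_; _+_; _*_; _-_; -_; 1/_; toℚᵘ; nonNegative; positive)
open import Data.Rational.Properties
import Data.Rational.Unnormalised.Base as ℚᵘ
import Data.Rational.Unnormalised.Properties as ℚᵘₚ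
open import Data.Rational.Solver using (module +-*-Solver)
open +-*-Solver using (solve; con; _:+_; _:*_; _:-_; :-_; _:=_)
open import Algebra.Properties.CommutativeSemiring.Exp (CommutativeRing.commutativeSemiring +-*-commutativeRing)
  using (^-homo-*; ^-assocʳ; ^-distrib-*)
open import Algebra.Properties.Semiring.Mult (CommutativeRing.semiring +-*-commutativeRing)
  using (×-homo-+; ×1-homo-*) renaming (_×_ to _×ℚ_)

-- As a multiple of 1 this unfolds to `1ℚ + ι n`, which suits induction and the ring solver;
-- `+ n / 1` would normalise a fraction instead.
ι : ℕ → ℚ
ι n = n ×ℚ 1ℚ

ι-+ : ∀ m n → ι (m ℕ.+ n) ≡ ι m + ι n
ι-+ = ×-homo-+ 1ℚ

ι-* : ∀ m n → ι (m ℕ.* n) ≡ ι m * ι n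
ι-* = ×1-homo-*

0≤+ : ∀ {p q} → 0ℚ ≤ p → 0ℚ ≤ q → 0ℚ ≤ p + q
0≤+ = +-mono-≤

*-monoʳ : ∀ r {p q} → 0ℚ ≤ r → p ≤ q → r * p ≤ r * q
*-monoʳ r 0≤r = *-monoˡ-≤-nonNeg r {{nonNegative 0≤r}}

*-monoˡ : ∀ r {p q} → 0ℚ ≤ r → p ≤ q → p * r ≤ q * r
*-monoˡ r 0≤r = *-monoʳ-≤-nonNeg r {{nonNegative 0≤r}}

0≤* : ∀ {p q} → 0ℚ ≤ p → 0ℚ ≤ q → 0ℚ ≤ p * q
0≤* {p} {q} 0≤p 0≤q = subst (_≤ p * q) (*-zeroʳ p) (*-monoʳ p 0≤p 0≤q)

*-mono : ∀ {p q r s} → 0ℚ ≤ p → 0ℚ ≤ s → p ≤ q → r ≤ s → p * r ≤ q * s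
*-mono {p} {q} {r} {s} 0≤p 0≤s p≤q r≤s = ≤-trans (*-monoʳ p 0≤p r≤s) (*-monoˡ s 0≤s p≤q)

p≤p+q : ∀ p {q} → 0ℚ ≤ q → p ≤ p + q
p≤p+q p {q} 0≤q = subst (_≤ p + q) (+-identityʳ p) (+-monoʳ-≤ p 0≤q)

p≤q+p : ∀ p {q} → 0ℚ ≤ q → p ≤ q + p
p≤q+p p {q} 0≤q = subst (p ≤_) (+-comm p q) (p≤p+q p 0≤q)

p≤q⇒0≤q-p : ∀ {p q} → p ≤ q → 0ℚ ≤ q - p
p≤q⇒0≤q-p {p} {q} p≤q = subst (_≤ q - p) (+-inverseʳ p) (+-monoˡ-≤ (- p) p≤q)

0≤1 : 0ℚ ≤ 1ℚ
0≤1 = nonNegative⁻¹ 1ℚ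

0≤½ : 0ℚ ≤ ½
0≤½ = nonNegative⁻¹ ½

0≤ι : ∀ n → 0ℚ ≤ ι n
0≤ι zero    = ≤-refl
0≤ι (suc n) = 0≤+ 0≤1 (0≤ι n)

ι-mono : ∀ {m n} → m ℕ.≤ n → ι m ≤ ι n
ι-mono {n = n} ℕ.z≤n = 0≤ι n
ι-mono (ℕ.s≤s m≤n) = +-monoʳ-≤ 1ℚ (ι-mono m≤n)

0<ι : ∀ n .{{_ : ℕ.NonZero n}} → 0ℚ < ι n
0<ι (suc n) = <-≤-trans (positive⁻¹ 1ℚ) (p≤p+q 1ℚ (0≤ι n))

ι≡/ : ∀ n → ι n ≡ + n / 1
ι≡/ zero    = refl
ι≡/ (suc n) = toℚᵘ-injective (begin
  toℚᵘ (1ℚ + ι n)             ≈⟨ toℚᵘ-homo-+ 1ℚ (ι n) ⟩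
  toℚᵘ 1ℚ ℚᵘ.+ toℚᵘ (ι n)       ≈⟨ ℚᵘₚ.+-congʳ (toℚᵘ 1ℚ) (toℚᵘ-cong (ι≡/ n)) ⟩
  toℚᵘ 1ℚ ℚᵘ.+ toℚᵘ (+ n / 1)   ≈⟨ ℚᵘₚ.+-congʳ (toℚᵘ 1ℚ) (toℚᵘ-fromℚᵘ (ℚᵘ.mkℚᵘ (+ n) 0)) ⟩
  ℚᵘ.mkℚᵘ (+ 1) 0 ℚᵘ.+ ℚᵘ.mkℚᵘ (+ n) 0
    ≈⟨ ℚᵘ.*≡* (cong (λ k → (+ 1 ℤ.+ k) ℤ.* + 1) (ℤₚ.*-identityʳ (+ n))) ⟩
  ℚᵘ.mkℚᵘ (+ suc n) 0          ≈⟨ ℚᵘₚ.≃-sym (toℚᵘ-fromℚᵘ (ℚᵘ.mkℚᵘ (+ suc n) 0)) ⟩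
  toℚᵘ (+ suc n / 1)          ∎)
  where open ℚᵘₚ.≃-Reasoning

1/ι : ∀ n .{{_ : ℕ.NonZero n}} → (+ 1 / n) * ι n ≡ 1ℚ
1/ι (suc k) = toℚᵘ-injective (begin
  toℚᵘ ((+ 1 / suc k) * ι (suc k))  ≈⟨ toℚᵘ-homo-* (+ 1 / suc k) (ι (suc k)) ⟩
  toℚᵘ (+ 1 / suc k) ℚᵘ.* toℚᵘ (ι (suc k))
    ≈⟨ ℚᵘₚ.*-cong (toℚᵘ-fromℚᵘ (ℚᵘ.mkℚᵘ (+ 1) k)) (ℚᵘₚ.≃-trans (toℚᵘ-cong (ι≡/ (suc k))) (toℚᵘ-fromℚᵘ (ℚᵘ.mkℚᵘ (+ suc k) 0))) ⟩
  ℚᵘ.mkℚᵘ (+ 1) k ℚᵘ.* ℚᵘ.mkℚᵘ (+ suc k) 0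
    ≈⟨ ℚᵘ.*≡* (cong +_ (trans (ℕₚ.*-identityʳ (1 ℕ.* suc k)) (cong (1 ℕ.*_) (sym (ℕₚ.*-identityʳ (suc k)))))) ⟩
  toℚᵘ 1ℚ ∎)
  where open ℚᵘₚ.≃-Reasoning

archimedean : ∀ p → ∃[ n ] p ≤ ι n
archimedean p@(mkℚ i d _) = ℤ.∣ i ∣ , toℚᵘ-cancel-≤ (ℚᵘₚ.≤-trans (ℚᵘ.*≤* bound)
  (ℚᵘₚ.≤-reflexive (ℚᵘₚ.≃-sym (ℚᵘₚ.≃-trans (toℚᵘ-cong (ι≡/ ℤ.∣ i ∣)) (toℚᵘ-fromℚᵘ (ℚᵘ.mkℚᵘ (+ ℤ.∣ i ∣) 0))))))
  where
  i≤∣i∣ : ∀ i → i ℤ.≤ + ℤ.∣ i ∣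
  i≤∣i∣ (+ n)      = ℤₚ.≤-refl
  i≤∣i∣ ℤ.-[1+ n ] = ℤ.-≤+
  bound : i ℤ.* + 1 ℤ.≤ + ℤ.∣ i ∣ ℤ.* + suc d
  bound = begin
    i ℤ.* + 1              ≡⟨ ℤₚ.*-identityʳ i ⟩
    i                      ≤⟨ i≤∣i∣ i ⟩
    + ℤ.∣ i ∣              ≤⟨ ℤ.+≤+ (ℕₚ.m≤m*n ℤ.∣ i ∣ (suc d)) ⟩
    + (ℤ.∣ i ∣ ℕ.* suc d)  ≡⟨ ℤₚ.pos-* ℤ.∣ i ∣ (suc d) ⟩
    + ℤ.∣ i ∣ ℤ.* + suc d  ∎
    where open ℤₚ.≤-Reasoning

ceiling : ∀ p → 0ℚ ≤ p → ∃[ n ] (p ≤ ι n × ι n ≤ p + 1ℚ)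
ceiling p 0≤p = let (n , p≤n) = archimedean p in search n p≤n
  where
  search : ∀ n → p ≤ ι n → ∃[ m ] (p ≤ ι m × ι m ≤ p + 1ℚ)
  search zero p≤0 = 0 , p≤0 , 0≤+ 0≤p 0≤1
  search (suc n) p≤1+n with ≤-total p (ι n)
  ... | inj₁ p≤n = search n p≤n
  ... | inj₂ n≤p = suc n , p≤1+n , subst (_≤ p + 1ℚ) (+-comm (ι n) 1ℚ) (+-monoˡ-≤ 1ℚ n≤p)

-- Powers and partial sums of the exponential series.

0≤pow : ∀ {p} n → 0ℚ ≤ p → 0ℚ ≤ pow p n
0≤pow zero    0≤p = 0≤1
0≤pow (suc n) 0≤p = 0≤* 0≤p (0≤pow n 0≤p)

pow-mono : ∀ {p q} n → 0ℚ ≤ p → p ≤ q → pow p n ≤ pow q n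
pow-mono zero    0≤p p≤q = ≤-refl
pow-mono (suc n) 0≤p p≤q = *-mono 0≤p (0≤pow n (≤-trans 0≤p p≤q)) p≤q (pow-mono n 0≤p p≤q)

pow-1 : ∀ n → pow 1ℚ n ≡ 1ℚ
pow-1 zero    = refl
pow-1 (suc n) = trans (*-identityˡ (pow 1ℚ n)) (pow-1 n)

module _ {s x : ℚ} (0≤s : 0ℚ ≤ s) (0≤x : 0ℚ ≤ x) where
  private
    0≤u : 0ℚ ≤ s + x
    0≤u = 0≤+ 0≤s 0≤x
  open ≤-Reasoning

  -- Convexity of the power function: its graph lies above the tangent at `s`. The induction
  -- discards only a term quadratic in `x`.
  pow-tangent-lower : ∀ k → pow s (suc k) + ι (suc k) * (x * pow s k) ≤ pow (s + x) (suc k)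
  pow-tangent-lower zero = ≤-reflexive
    (solve 2 (λ s x → s :* con 1ℚ :+ (con 1ℚ :+ con 0ℚ) :* (x :* con 1ℚ) := (s :+ x) :* con 1ℚ)
        refl s x)
  pow-tangent-lower (suc k) = begin
    s * (s * a) + (1ℚ + n) * (x * (s * a))
      ≤⟨ p≤p+q _ (0≤* (0≤* (0≤ι (suc k)) (0≤* 0≤x 0≤x)) (0≤pow k 0≤s)) ⟩
    s * (s * a) + (1ℚ + n) * (x * (s * a)) + (n * (x * x)) * a
      ≡⟨ solve 4 (λ s x n a → s :* (s :* a) :+ (con 1ℚ :+ n) :* (x :* (s :* a)) :+ (n :* (x :* x)) :* a
           := (s :+ x) :* (s :* a :+ n :* (x :* a))) refl s x n a ⟩
    (s + x) * (s * a + n * (x * a))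
      ≤⟨ *-monoʳ (s + x) 0≤u (pow-tangent-lower k) ⟩
    (s + x) * pow (s + x) (suc k) ∎
    where a = pow s k
          n = ι (suc k)

  -- The same convexity, with the slope taken at the right end `s + x`.
  pow-tangent-upper : ∀ k → pow (s + x) (suc k) ≤ pow s (suc k) + ι (suc k) * (x * pow (s + x) k)
  pow-tangent-upper zero = ≤-reflexive
    (solve 2 (λ s x → (s :+ x) :* con 1ℚ := s :* con 1ℚ :+ (con 1ℚ :+ con 0ℚ) :* (x :* con 1ℚ))
        refl s x)
  pow-tangent-upper (suc k) = begin
    (s + x) * (u * a)
      ≤⟨ *-monoʳ (s + x) 0≤u (pow-tangent-upper k) ⟩
    u * (s * b + n * (x * a))
      ≡⟨ solve 5 (λ s x n a b → (s :+ x) :* (s :* b :+ n :* (x :* a))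
           := s :* (s :* b) :+ x :* (s :* b) :+ n :* (x :* ((s :+ x) :* a))) refl s x n a b ⟩
    s * (s * b) + x * (s * b) + n * (x * (u * a))
      ≤⟨ +-monoˡ-≤ (n * (x * (u * a))) (+-monoʳ-≤ (s * (s * b)) (*-monoʳ x 0≤x (pow-mono (suc k) 0≤s (p≤p+q s 0≤x)))) ⟩
    s * (s * b) + x * (u * a) + n * (x * (u * a))
      ≡⟨ solve 3 (λ c d n → c :+ d :+ n :* d := c :+ (con 1ℚ :+ n) :* d)
          refl (s * (s * b)) (x * (u * a)) n ⟩
    s * (s * b) + (1ℚ + n) * (x * (u * a)) ∎
    where u = s + x
          a = pow (s + x) k
          b = pow s k
          n = ι (suc k)

sumℚ-∷ʳ : ∀ ps p → sumℚ (ps ∷ʳ p) ≡ sumℚ ps + p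
sumℚ-∷ʳ []       p = +-comm p 0ℚ
sumℚ-∷ʳ (q ∷ ps) p = trans (cong (λ z → q + z) (sumℚ-∷ʳ ps p)) (sym (+-assoc q (sumℚ ps) p))

expSum-suc : ∀ r N → expSum r (suc N) ≡ expSum r N + expTerm r N
expSum-suc r N = begin
  sumℚ (map (expTerm r) (upTo (suc N)))
    ≡⟨ cong (λ l → sumℚ (map (expTerm r) l)) (sym (Listₚ.applyUpTo-∷ʳ (λ n → n) N)) ⟩
  sumℚ (map (expTerm r) (upTo N ∷ʳ N))
    ≡⟨ cong sumℚ (Listₚ.map-++ (expTerm r) (upTo N) (N ∷ [])) ⟩
  sumℚ (map (expTerm r) (upTo N) ∷ʳ expTerm r N)
    ≡⟨ sumℚ-∷ʳ (map (expTerm r) (upTo N)) (expTerm r N) ⟩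
  expSum r N + expTerm r N                         ∎
  where open ≡-Reasoning

1/! : ℕ → ℚ
1/! k = (+ 1 / (k !)) {{k ℕₚ.!≢0}}

0≤1/! : ∀ k → 0ℚ ≤ 1/! k
0≤1/! k = nonNegative⁻¹ (1/! k) {{normalize-nonNeg 1 (k !) {{k ℕₚ.!≢0}}}}

1/!-suc : ∀ k → ι (suc k) * 1/! (suc k) ≡ 1/! k
1/!-suc k = begin
  n * f′                    ≡⟨ *-identityʳ _ ⟨
  (n * f′) * 1ℚ             ≡⟨ cong (λ z → (n * f′) * z) (1/ι (k !) {{k ℕₚ.!≢0}}) ⟨
  (n * f′) * (f * c)
    ≡⟨ solve 4 (λ n f f′ c → (n :* f′) :* (f :* c) := f :* (f′ :* (n :* c))) refl n f f′ c ⟩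
  f * (f′ * (n * c))        ≡⟨ cong (λ z → f * (f′ * z)) (ι-* (suc k) (k !)) ⟨
  f * (f′ * ι (suc k !))    ≡⟨ cong (λ z → f * z) (1/ι (suc k !) {{suc k ℕₚ.!≢0}}) ⟩
  f * 1ℚ                    ≡⟨ *-identityʳ _ ⟩
  f                         ∎
  where
  open ≡-Reasoning
  n = ι (suc k)
  f′ = 1/! (suc k)
  f = 1/! k
  c = ι (k !)

0≤expTerm : ∀ {r} k → 0ℚ ≤ r → 0ℚ ≤ expTerm r k
0≤expTerm k 0≤r = 0≤* (0≤pow k 0≤r) (0≤1/! k)

expSum-mono : ∀ {r s} N → 0ℚ ≤ r → r ≤ s → expSum r N ≤ expSum s N
expSum-mono zero    0≤r r≤s = ≤-refl
expSum-mono {r} {s} (suc N) 0≤r r≤s = subst₂ _≤_ (sym (expSum-suc r N)) (sym (expSum-suc s N))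
  (+-mono-≤ (expSum-mono N 0≤r r≤s) (*-monoˡ (1/! N) (0≤1/! N) (pow-mono N 0≤r r≤s)))

expSum-≤-suc : ∀ {r} N → 0ℚ ≤ r → expSum r N ≤ expSum r (suc N)
expSum-≤-suc {r} N 0≤r = subst (expSum r N ≤_) (sym (expSum-suc r N)) (p≤p+q (expSum r N) (0≤expTerm N 0≤r))

expSum-0 : ∀ N → expSum 0ℚ N ≤ 1ℚ
expSum-0 zero          = 0≤1
expSum-0 (suc zero)    = ≤-refl
expSum-0 (suc (suc N)) = begin
  expSum 0ℚ (2 ℕ.+ N)                               ≡⟨ expSum-suc 0ℚ (suc N) ⟩
  expSum 0ℚ (suc N) + (0ℚ * pow 0ℚ N) * 1/! (suc N)
    ≡⟨ solve 3 (λ a b c → a :+ (con 0ℚ :* b) :* c := a)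
        refl (expSum 0ℚ (suc N)) (pow 0ℚ N) (1/! (suc N)) ⟩
  expSum 0ℚ (suc N)                                 ≤⟨ expSum-0 (suc N) ⟩
  1ℚ                                                ∎
  where open ≤-Reasoning

-- Each term of the series has the preceding term as its derivative; this is what the slope becomes
-- after division by the factorial.
expTerm-tangent : ∀ a x r k → (a + ι (suc k) * (x * pow r k)) * 1/! (suc k) ≡ a * 1/! (suc k) + x * expTerm r k
expTerm-tangent a x r k = trans
  (solve 5 (λ a n x b f → (a :+ n :* (x :* b)) :* f := a :* f :+ x :* (b :* (n :* f))) refl
    a (ι (suc k)) x (pow r k) (1/! (suc k)))
  (cong (λ z → a * 1/! (suc k) + x * (pow r k * z)) (1/!-suc k))

module _ {s x : ℚ} (0≤s : 0ℚ ≤ s) (0≤x : 0ℚ ≤ x) where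
  open ≤-Reasoning

  expTerm-tangent-lower : ∀ k → expTerm s (suc k) + x * expTerm s k ≤ expTerm (s + x) (suc k)
  expTerm-tangent-lower k = begin
    expTerm s (suc k) + x * expTerm s k
      ≡⟨ expTerm-tangent (pow s (suc k)) x s k ⟨
    (pow s (suc k) + ι (suc k) * (x * pow s k)) * 1/! (suc k)
      ≤⟨ *-monoˡ _ (0≤1/! (suc k)) (pow-tangent-lower 0≤s 0≤x k) ⟩
    expTerm (s + x) (suc k)                                   ∎

  -- A truncated form of exp' = exp: differentiating a partial sum drops one term, hence `suc N`
  -- beside `N`.
  expSum-tangent-lower : ∀ N → expSum s (suc N) + x * expSum s N ≤ expSum (s + x) (suc N)
  expSum-tangent-lower zero = ≤-reflexive (solve 1 (λ x → con 1ℚ :+ x :* con 0ℚ := con 1ℚ) refl x)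
  expSum-tangent-lower (suc N) = begin
    expSum s (2 ℕ.+ N) + x * expSum s (suc N)
      ≡⟨ cong₂ (λ y z → y + x * z) (expSum-suc s (suc N)) (expSum-suc s N) ⟩
    (expSum s (suc N) + t′) + x * (expSum s N + t)
      ≡⟨ solve 5 (λ a b x t t′ → (a :+ t′) :+ x :* (b :+ t) := (a :+ x :* b) :+ (t′ :+ x :* t))
          refl (expSum s (suc N)) (expSum s N) x t t′ ⟩
    (expSum s (suc N) + x * expSum s N) + (t′ + x * t)
      ≤⟨ +-mono-≤ (expSum-tangent-lower N) (expTerm-tangent-lower N) ⟩
    expSum (s + x) (suc N) + expTerm (s + x) (suc N)
      ≡⟨ expSum-suc (s + x) (suc N) ⟨
    expSum (s + x) (2 ℕ.+ N) ∎
    where t = expTerm s N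
          t′ = expTerm s (suc N)

  -- Plays the role of 1 + x ≤ exp x. The right-hand side pays with one more term of the series.
  expSum-*-1+x : ∀ N → expSum s N * (1ℚ + x) ≤ expSum (s + x) (suc N)
  expSum-*-1+x N = begin
    expSum s N * (1ℚ + x)
      ≡⟨ solve 2 (λ a x → a :* (con 1ℚ :+ x) := a :+ x :* a) refl (expSum s N) x ⟩
    expSum s N + x * expSum s N        ≤⟨ +-monoˡ-≤ _ (expSum-≤-suc N 0≤s) ⟩
    expSum s (suc N) + x * expSum s N  ≤⟨ expSum-tangent-lower N ⟩
    expSum (s + x) (suc N)             ∎

  private
    u = s + x
    0≤u = 0≤+ 0≤s 0≤x

  expSum-tangent-upper : ∀ N → expSum u (suc N) ≤ expSum s (suc N) + x * expSum u N
  expSum-tangent-upper zero = ≤-reflexive (solve 1 (λ x → con 1ℚ := con 1ℚ :+ x :* con 0ℚ) refl x)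
  expSum-tangent-upper (suc N) = begin
    expSum u (2 ℕ.+ N)
      ≡⟨ expSum-suc u (suc N) ⟩
    expSum u (suc N) + expTerm u (suc N)
      ≤⟨ +-mono-≤ (expSum-tangent-upper N) (*-monoˡ _ (0≤1/! (suc N)) (pow-tangent-upper 0≤s 0≤x N)) ⟩
    (expSum s (suc N) + x * expSum u N) + (pow s (suc N) + ι (suc N) * (x * pow u N)) * 1/! (suc N)
      ≡⟨ cong (λ z → (expSum s (suc N) + x * expSum u N) + z) (expTerm-tangent (pow s (suc N)) x u N) ⟩
    (expSum s (suc N) + x * expSum u N) + (t′ + x * t)
      ≡⟨ solve 5 (λ a b x t t′ → (a :+ x :* b) :+ (t′ :+ x :* t) := (a :+ t′) :+ x :* (b :+ t))
          refl (expSum s (suc N)) (expSum u N) x t t′ ⟩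
    (expSum s (suc N) + t′) + x * (expSum u N + t)
      ≡⟨ cong₂ (λ y z → y + x * z) (expSum-suc s (suc N)) (expSum-suc u N) ⟨
    expSum s (2 ℕ.+ N) + x * expSum u (suc N) ∎
    where
    t = expTerm u N
    t′ = expTerm s (suc N)

  -- Plays the role of 1 - x ≤ exp (-x) without a negative argument, and at the same truncation on
  -- both sides, so that it can be iterated.
  expSum-*-1-x : ∀ N → expSum u N * (1ℚ - x) ≤ expSum s N
  expSum-*-1-x zero    = ≤-reflexive (*-zeroˡ (1ℚ - x))
  expSum-*-1-x (suc N) = begin
    expSum u (suc N) * (1ℚ - x)
      ≡⟨ solve 2 (λ a x → a :* (con 1ℚ :- x) := a :+ :- (x :* a)) refl (expSum u (suc N)) x ⟩
    expSum u (suc N) - x * expSum u (suc N)        ≤⟨ +-monoˡ-≤ _ (expSum-tangent-upper N) ⟩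
    (expSum s (suc N) + x * expSum u N) - x * expSum u (suc N)
      ≤⟨ +-monoˡ-≤ _ (+-monoʳ-≤ (expSum s (suc N)) (*-monoʳ x 0≤x (expSum-≤-suc N 0≤u))) ⟩
    (expSum s (suc N) + x * expSum u (suc N)) - x * expSum u (suc N)
      ≡⟨ solve 2 (λ a b → (a :+ b) :+ :- b := a) refl (expSum s (suc N)) (x * expSum u (suc N)) ⟩
    expSum s (suc N) ∎

-- Iterating the previous inequality `M` times gives (1-x)^M ≤ exp(-Mx) in product form, for all
-- partial sums at once.
expSum-*-pow : ∀ {x} → 0ℚ ≤ x → x ≤ 1ℚ → ∀ M N → expSum (ι M * x) N * pow (1ℚ - x) M ≤ 1ℚ
expSum-*-pow {x} 0≤x x≤1 zero N = begin
  expSum (0ℚ * x) N * 1ℚ  ≡⟨ *-identityʳ _ ⟩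
  expSum (0ℚ * x) N       ≡⟨ cong (λ z → expSum z N) (*-zeroˡ x) ⟩
  expSum 0ℚ N             ≤⟨ expSum-0 N ⟩
  1ℚ                      ∎
  where open ≤-Reasoning
expSum-*-pow {x} 0≤x x≤1 (suc M) N = begin
  expSum (ι (suc M) * x) N * ((1ℚ - x) * y)
    ≡⟨ cong (λ z → expSum z N * ((1ℚ - x) * y)) (solve 2 (λ m x → (con 1ℚ :+ m) :* x := m :* x :+ x)
        refl (ι M) x) ⟩
  expSum (ι M * x + x) N * ((1ℚ - x) * y)      ≡⟨ *-assoc (expSum (ι M * x + x) N) (1ℚ - x) y ⟨
  expSum (ι M * x + x) N * (1ℚ - x) * y
    ≤⟨ *-monoˡ y (0≤pow M 0≤1-x) (expSum-*-1-x (0≤* (0≤ι M) 0≤x) 0≤x N) ⟩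
  expSum (ι M * x) N * y                       ≤⟨ expSum-*-pow 0≤x x≤1 M N ⟩
  1ℚ                                           ∎
  where
  open ≤-Reasoning
  y = pow (1ℚ - x) M
  0≤1-x = p≤q⇒0≤q-p x≤1

inverse : ∀ {p} → 0ℚ < p → ∃[ r ] (0ℚ < r × p * r ≡ 1ℚ)
inverse {p} 0<p = r , positive⁻¹ r {{1/pos⇒pos p {{positive 0<p}}}} , *-inverseʳ p {{pos⇒nonZero p {{positive 0<p}}}}
  where r = (1/ p) {{pos⇒nonZero p {{positive 0<p}}}}

2ℚ : ℚ
2ℚ = + 2 / 1

-- If the power exceeded 1/2, its reciprocal would be a bound below 2 for all partial sums at `l`,
-- and so would put exp l below 2. The argument is by contradiction because the hypothesis on
-- `exp l` only restricts its upper bounds and names no large partial sum.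
pow-≤-½ : ∀ {l x} → fromℚ 2ℚ ≤ʳ exp l → 0ℚ ≤ l → 0ℚ ≤ x → x ≤ 1ℚ → ∀ M → l ≤ ι M * x → pow (1ℚ - x) M ≤ ½
pow-≤-½ {l} {x} 2≤exp 0≤l 0≤x x≤1 M l≤Mx = ≮⇒≥ contra
  where
  y = pow (1ℚ - x) M
  contra : ½ < y → ⊥
  contra ½<y =
    let 0<y = <-trans (positive⁻¹ ½) ½<y
        (r , 0<r , yr≡1) = inverse 0<y
        partial : ∀ N → expSum l N ≤ r
        partial N = begin
          expSum l N                   ≤⟨ expSum-mono N 0≤l l≤Mx ⟩
          expSum (ι M * x) N           ≡⟨ *-identityʳ _ ⟨
          expSum (ι M * x) N * 1ℚ      ≡⟨ cong (λ z → expSum (ι M * x) N * z) yr≡1 ⟨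
          expSum (ι M * x) N * (y * r) ≡⟨ *-assoc (expSum (ι M * x) N) y r ⟨
          expSum (ι M * x) N * y * r   ≤⟨ *-monoˡ r (<⇒≤ 0<r) (expSum-*-pow 0≤x x≤1 M N) ⟩
          1ℚ * r                       ≡⟨ *-identityˡ r ⟩
          r                            ∎
        r<2 : r < 2ℚ
        r<2 = begin-strict
          r                            ≡⟨ solve 1 (λ r → r := (con ½ :* r) :* con 2ℚ) refl r ⟩
          ½ * r * 2ℚ                   <⟨ *-monoˡ-<-pos 2ℚ (*-monoˡ-<-pos r {{positive 0<r}} ½<y) ⟩
          y * r * 2ℚ                   ≡⟨ cong (λ z → z * 2ℚ) yr≡1 ⟩
          2ℚ                           ∎
        (t , _ , 2≤t , t<2) = 2≤exp 2ℚ (r , <⇒≤ 0<r , partial , r<2)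
    in <-irrefl refl (≤-<-trans 2≤t t<2)
    where open ≤-Reasoning

-- Greedy choice of n-subsets.

Fits : ∀ {v} → Vec Bool v → Subset v → Set
Fits c s = ∃[ b ] fits b c s ≡ true

survivors : ∀ {v} → Subset v → List (Vec Bool v) → List (Vec Bool v)
survivors s = filterᵇ (λ c → not (fits true c s ∨ fits false c s))

survives-or-fits : ∀ {v} (s : Subset v) cs {c} → c ∈ cs → c ∈ survivors s cs ⊎ Fits c s
survives-or-fits s (c ∷ cs) (here refl) with fits true c s in t | fits false c s in f
... | true  | _     = inj₂ (true , t)
... | false | true  = inj₂ (false , f)
... | false | false = inj₁ (here refl)
survives-or-fits s (c ∷ cs) (there c∈) with fits true c s | fits false c s
... | true  | _     = survives-or-fits s cs c∈
... | false | true  = survives-or-fits s cs c∈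
... | false | false = Sum.map₁ there (survives-or-fits s cs c∈)

-- As `s` is nonempty, no colouring counts twice in the total, so each unit of it pays for one
-- removed colouring.
survivors-count : ∀ {v} (s : Subset v) → 1 ℕ.≤ ∣ s ∣ → ∀ cs →
  length (survivors s cs) ℕ.+ total (λ c → mono c s) cs ℕ.≤ length cs
survivors-count s 1≤∣s∣ [] = z≤n
survivors-count s 1≤∣s∣ (c ∷ cs) with fits true c s in t | fits false c s in f
... | true  | true  = contradiction (fits-both c s t f) (ℕₚ.>⇒≢ 1≤∣s∣)
... | true  | false = subst (ℕ._≤ suc (length cs)) (sym (ℕₚ.+-suc _ _)) (s≤s (survivors-count s 1≤∣s∣ cs))
... | false | true  = subst (ℕ._≤ suc (length cs)) (sym (ℕₚ.+-suc _ _)) (s≤s (survivors-count s 1≤∣s∣ cs))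
... | false | false = s≤s (survivors-count s 1≤∣s∣ cs)

binom-pos : ∀ {n k} → k ℕ.≤ n → 1 ℕ.≤ binom n k
binom-pos {k = zero} _ = s≤s z≤n
binom-pos {suc n} {suc k} (s≤s k≤n) = ℕₚ.≤-trans (binom-pos k≤n) (ℕₚ.m≤m+n (binom n k) (binom n (suc k)))

-- Double counting: convexity gives every colouring at least 2 C(h,n) monochromatic `n`-subsets, so
-- after exchanging the sums some subset reaches the average. Denominators are cleared.
good-edge : ∀ h n → n ℕ.≤ h → (cs : List (Vec Bool (h ℕ.+ h))) → ∃[ s ] (∣ s ∣ ≡ n ×
  length cs ℕ.* (binom h n ℕ.+ binom h n) ℕ.≤ binom (h ℕ.+ h) n ℕ.* total (λ c → mono c s) cs)
good-edge h n n≤h cs with k-subsets (h ℕ.+ h) n in eq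
... | [] = contradiction (binom-pos (ℕₚ.≤-trans n≤h (ℕₚ.m≤m+n h h)))
  (λ pos → ℕₚ.<⇒≢ pos (trans (cong length (sym eq)) (length-k-subsets (h ℕ.+ h) n)))
... | s₀ ∷ ss =
  let (s , s∈ , avg) = average (λ s → total (λ c → mono c s) cs) s₀ ss
  in s , All.lookup (subst (All (λ s → ∣ s ∣ ≡ n)) eq (k-subsets-size (h ℕ.+ h) n)) s∈ , (begin
    length cs ℕ.* (binom h n ℕ.+ binom h n)
      ≤⟨ total-≥ (λ c → mono-total h c n) cs ⟩
    total (λ c → total (mono c) (k-subsets (h ℕ.+ h) n)) cs
      ≡⟨ total-swap mono cs (k-subsets (h ℕ.+ h) n) ⟩
    total (λ s → total (λ c → mono c s) cs) (k-subsets (h ℕ.+ h) n) ≡⟨ cong (total _) eq ⟩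
    total (λ s → total (λ c → mono c s) cs) (s₀ ∷ ss)          ≤⟨ avg ⟩
    length (s₀ ∷ ss) ℕ.* total (λ c → mono c s) cs
      ≡⟨ cong (ℕ._* total (λ c → mono c s) cs) (trans (cong length (sym eq)) (length-k-subsets (h ℕ.+ h) n)) ⟩
    binom (h ℕ.+ h) n ℕ.* total (λ c → mono c s) cs            ∎)
  where open ℕₚ.≤-Reasoning

module Greedy {h n} (1≤n : 1 ℕ.≤ n) (n≤h : n ℕ.≤ h) {x} (x≤1 : x ≤ 1ℚ)
  (x-bound : x * ι (binom (h ℕ.+ h) n) ≤ ι (binom h n ℕ.+ binom h n)) where

  private
    D = binom (h ℕ.+ h) n
    K = binom h n ℕ.+ binom h n
    0≤1-x : 0ℚ ≤ 1ℚ - x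
    0≤1-x = p≤q⇒0≤q-p x≤1

  -- Here `x` is any rational at most 2 C(h,n) / C(2h,n), the fraction of `n`-subsets guaranteed to
  -- be monochromatic. The set that reaches the average removes at least that fraction of the
  -- colourings.
  step : (cs : List (Vec Bool (h ℕ.+ h))) → ∃[ s ] (∣ s ∣ ≡ n × ι (length (survivors s cs)) ≤ (1ℚ - x) * ι (length cs))
  step cs with good-edge h n n≤h cs
  ... | s , ∣s∣≡n , killed-bound = s , ∣s∣≡n , (begin
    ι L                             ≡⟨ solve 2 (λ l t → l := (l :+ t) :- t) refl (ι L) (ι t) ⟩
    (ι L + ι t) - ι t               ≡⟨ cong (λ z → z - ι t) (ι-+ L t) ⟨
    ι (L ℕ.+ t) - ι t
      ≤⟨ +-mono-≤ (ι-mono (survivors-count s (ℕₚ.≤-trans 1≤n (ℕₚ.≤-reflexive (sym ∣s∣≡n))) cs)) (neg-antimono-≤ xN≤t) ⟩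
    ι N - x * ι N
      ≡⟨ solve 2 (λ x n → n :- x :* n := (con 1ℚ :- x) :* n) refl x (ι N) ⟩
    (1ℚ - x) * ι N                  ∎)
    where
    open ≤-Reasoning
    L = length (survivors s cs)
    N = length cs
    t = total (λ c → mono c s) cs
    0<D : 0ℚ < ι D
    0<D = 0<ι D {{ℕ.>-nonZero (binom-pos (ℕₚ.≤-trans n≤h (ℕₚ.m≤m+n h h)))}}
    xN≤t : x * ι N ≤ ι t
    xN≤t = *-cancelʳ-≤-pos (ι D) {{positive 0<D}} (begin
      x * ι N * ι D       ≡⟨ solve 3 (λ x n d → (x :* n) :* d := n :* (x :* d)) refl x (ι N) (ι D) ⟩
      ι N * (x * ι D)     ≤⟨ *-monoʳ (ι N) (0≤ι N) x-bound ⟩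
      ι N * ι K           ≡⟨ ι-* N K ⟨
      ι (N ℕ.* K)         ≤⟨ ι-mono killed-bound ⟩
      ι (D ℕ.* t)         ≡⟨ ι-* D t ⟩
      ι D * ι t           ≡⟨ *-comm (ι D) (ι t) ⟩
      ι t * ι D           ∎)

  -- Exactly `m` rounds are run, even if no colouring is left before the end. With `1 ≤ m` this
  -- later guarantees an edge of size exactly `n`.
  cover : ∀ m (cs : List (Vec Bool (h ℕ.+ h))) → ∃[ es ] ∃[ rest ]
    ( length es ≡ m
    × All (λ s → ∣ s ∣ ≡ n) es
    × (∀ {c} → c ∈ cs → Any (Fits c) es ⊎ c ∈ rest)
    × ι (length rest) ≤ pow (1ℚ - x) m * ι (length cs))
  cover zero    cs = [] , cs , refl , [] , inj₂ , ≤-reflexive (sym (*-identityˡ (ι (length cs))))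
  cover (suc m) cs =
    let (s , ∣s∣≡n , shrink) = step cs
        (es , rest , len , sizes , covers , bound) = cover m (survivors s cs)
        covers′ : ∀ {c} → c ∈ cs → Any (Fits c) (s ∷ es) ⊎ c ∈ rest
        covers′ c∈ = Sum.[ (λ c∈′ → Sum.map₁ there (covers c∈′)) , (λ fit → inj₁ (here fit)) ]′ (survives-or-fits s cs c∈)
    in s ∷ es , rest , cong suc len , ∣s∣≡n ∷ sizes , covers′ , (begin
      ι (length rest)                                       ≤⟨ bound ⟩
      pow (1ℚ - x) m * ι (length (survivors s cs))
        ≤⟨ *-monoʳ (pow (1ℚ - x) m) (0≤pow m 0≤1-x) shrink ⟩
      pow (1ℚ - x) m * ((1ℚ - x) * ι (length cs))
        ≡⟨ solve 3 (λ a y l → a :* (y :* l) := (y :* a) :* l)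
            refl (pow (1ℚ - x) m) (1ℚ - x) (ι (length cs)) ⟩
      pow (1ℚ - x) (suc m) * ι (length cs)                  ∎)
    where open ≤-Reasoning

-- Edge weights and the hypergraph without proper 2-colouring.

colourings : ∀ v → List (Vec Bool v)
colourings zero    = [] ∷ []
colourings (suc v) = map (true ∷_) (colourings v) ++ map (false ∷_) (colourings v)

∈-colourings : ∀ {v} (c : Vec Bool v) → c ∈ colourings v
∈-colourings []          = here refl
∈-colourings (true ∷ c)  = ∈ₚ.∈-++⁺ˡ (∈ₚ.∈-map⁺ (true ∷_) (∈-colourings c))
∈-colourings (false ∷ c) = ∈ₚ.∈-++⁺ʳ (map (true ∷_) (colourings _)) (∈ₚ.∈-map⁺ (false ∷_) (∈-colourings c))

colourings-count : ∀ v → pow ½ v * ι (length (colourings v)) ≡ 1ℚ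
colourings-count zero    = refl
colourings-count (suc v) = begin
  ½ * pow ½ v * ι (length (colourings (suc v)))
    ≡⟨ cong (λ z → ½ * pow ½ v * ι z) (trans (Listₚ.length-++ (map (true ∷_) (colourings v)))
                                                       (cong₂ ℕ._+_ (Listₚ.length-map (true ∷_) (colourings v))
                                                                   (Listₚ.length-map (false ∷_) (colourings v)))) ⟩
  ½ * pow ½ v * ι (N ℕ.+ N)                       ≡⟨ cong (λ z → ½ * pow ½ v * z) (ι-+ N N) ⟩
  ½ * pow ½ v * (ι N + ι N)
    ≡⟨ solve 2 (λ p n → (con ½ :* p) :* (n :+ n) := p :* n) refl (pow ½ v) (ι N) ⟩
  pow ½ v * ι N                                   ≡⟨ colourings-count v ⟩
  1ℚ                                              ∎
  where
  open ≡-Reasoning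
  N = length (colourings v)

majority : ∀ h (c : Vec Bool (h ℕ.+ h)) → ∃[ b ] h ℕ.≤ ∣ class b c ∣
majority h c with ℕₚ.≤-total h (∣ class true c ∣)
... | inj₁ h≤t = true , h≤t
... | inj₂ t≤h = false , ℕₚ.+-cancelˡ-≤ h h (∣ class false c ∣)
  (ℕₚ.≤-trans (ℕₚ.≤-reflexive (sym (∣classes∣ c))) (ℕₚ.+-monoˡ-≤ (∣ class false c ∣) t≤h))

majority-class : ∀ h → Vec Bool (h ℕ.+ h) → Subset (h ℕ.+ h)
majority-class h c = class (proj₁ (majority h c)) c

pow-½-antimono : ∀ {m n} → m ℕ.≤ n → pow ½ n ≤ pow ½ m
pow-½-antimono {n = zero}  z≤n = ≤-refl
pow-½-antimono {n = suc n} z≤n = begin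
  ½ * pow ½ n    ≤⟨ *-monoʳ ½ 0≤½ (pow-½-antimono {n = n} z≤n) ⟩
  ½ * 1ℚ         ≤⟨ ≤ᵇ⇒≤ _ ⟩
  1ℚ             ∎
  where open ≤-Reasoning
pow-½-antimono (s≤s m≤n) = *-monoʳ ½ 0≤½ (pow-½-antimono m≤n)

edgeWeight : ∀ {v} → List (Subset v) → ℚ
edgeWeight es = sumℚ (map (λ s → pow ½ ∣ s ∣) es)

edgeWeight-++ : ∀ {v} (es fs : List (Subset v)) → edgeWeight (es ++ fs) ≡ edgeWeight es + edgeWeight fs
edgeWeight-++ []       fs = sym (+-identityˡ (edgeWeight fs))
edgeWeight-++ (s ∷ es) fs = trans
  (cong (λ z → pow ½ ∣ s ∣ + z) (edgeWeight-++ es fs))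
  (sym (+-assoc (pow ½ ∣ s ∣) (edgeWeight es) (edgeWeight fs)))

edgeWeight-≤ : ∀ {v k} {es : List (Subset v)} → All (λ s → k ℕ.≤ ∣ s ∣) es → edgeWeight es ≤ ι (length es) * pow ½ k
edgeWeight-≤ {k = k} [] = ≤-reflexive (sym (*-zeroˡ (pow ½ k)))
edgeWeight-≤ {k = k} {s ∷ es} (k≤s ∷ sizes) = begin
  pow ½ ∣ s ∣ + edgeWeight es               ≤⟨ +-mono-≤ (pow-½-antimono k≤s) (edgeWeight-≤ sizes) ⟩
  pow ½ k + ι (length es) * pow ½ k
    ≡⟨ solve 2 (λ p l → p :+ l :* p := (con 1ℚ :+ l) :* p) refl (pow ½ k) (ι (length es)) ⟩
  (1ℚ + ι (length es)) * pow ½ k            ∎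
  where open ≤-Reasoning

0≤edgeWeight : ∀ {v} (es : List (Subset v)) → 0ℚ ≤ edgeWeight es
0≤edgeWeight []       = ≤-refl
0≤edgeWeight (s ∷ es) = 0≤+ (0≤pow ∣ s ∣ 0≤½) (0≤edgeWeight es)

edgeWeight-filter : ∀ {v} {P : Subset v → Set} (P? : Decidable P) es → edgeWeight (filter P? es) ≤ edgeWeight es
edgeWeight-filter P? []       = ≤-refl
edgeWeight-filter P? (s ∷ es) with does (P? s)
... | true  = +-monoʳ-≤ (pow ½ ∣ s ∣) (edgeWeight-filter P? es)
... | false = ≤-trans (edgeWeight-filter P? es) (p≤q+p (edgeWeight es) (0≤pow ∣ s ∣ 0≤½))

_≟ₛ_ : ∀ {v} (s t : Subset v) → _
_≟ₛ_ = Vecₚ.≡-dec Boolₚ._≟_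

edgeWeight-deduplicate : ∀ {v} (es : List (Subset v)) → edgeWeight (deduplicate _≟ₛ_ es) ≤ edgeWeight es
edgeWeight-deduplicate []       = ≤-refl
edgeWeight-deduplicate (s ∷ es) = +-monoʳ-≤ (pow ½ ∣ s ∣)
  (≤-trans (edgeWeight-filter _ (deduplicate _≟ₛ_ es)) (edgeWeight-deduplicate es))

-- The hypothesis on `pow (1ℚ - x) m` is the stopping rule: it leaves at most 2^h of the 2^(2h)
-- colourings. Chosen sets and majority classes may coincide; deduplication makes the edges
-- distinct, keeps every set as an edge and cannot raise the weight.
sparse-obstruction : ∀ {h n m} → 2 ℕ.≤ n → n ℕ.≤ h → 1 ℕ.≤ m → ∀ {x} → x ≤ 1ℚ →
  x * ι (binom (h ℕ.+ h) n) ≤ ι (binom h n ℕ.+ binom h n) → pow (1ℚ - x) m ≤ pow ½ h →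
  ∃[ H ] (¬ TwoColourable H × SmallestEdge H n × weight H ≤ ι m * pow ½ n + 1ℚ)
sparse-obstruction {h} {n} {m} 2≤n n≤h 1≤m {x} x≤1 x-bound few
  with Greedy.cover (ℕₚ.≤-trans (s≤s z≤n) 2≤n) n≤h x≤1 x-bound m (colourings (h ℕ.+ h))
... | es , rest , len , sizes , covers , bound =
  H , not-colourable , (exact , Allₚ.deduplicate⁺ _≟ₛ_ all-≥n) , weight-bound
  where
  all-edges : List (Subset (h ℕ.+ h))
  all-edges = es ++ map (majority-class h) rest

  rest-sizes : All (λ s → h ℕ.≤ ∣ s ∣) (map (majority-class h) rest)
  rest-sizes = Allₚ.map⁺ (All.universal (λ c → proj₂ (majority h c)) rest)

  all-≥n : All (λ s → n ℕ.≤ ∣ s ∣) all-edges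
  all-≥n = Allₚ.++⁺ (All.map (λ eq → ℕₚ.≤-reflexive (sym eq)) sizes) (All.map (ℕₚ.≤-trans n≤h) rest-sizes)

  H : Hypergraph
  H = record
    { order    = h ℕ.+ h
    ; edges    = deduplicate _≟ₛ_ all-edges
    ; distinct = Uniqueₚ.deduplicate-! _≟ₛ_ all-edges
    ; nontriv  = Allₚ.deduplicate⁺ _≟ₛ_ (All.map (ℕₚ.≤-trans 2≤n) all-≥n)
    }

  dedup : ∀ {P : Subset (h ℕ.+ h) → Set} → Any P all-edges → Any P (edges H)
  dedup {P} = Anyₚ.deduplicate⁺ _≟ₛ_ (λ eq → subst P (sym eq))

  first : ∀ {fs} → length fs ≡ m → All (λ s → ∣ s ∣ ≡ n) fs → Any (λ s → ∣ s ∣ ≡ n) fs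
  first {[]}    refl []       = contradiction 1≤m λ ()
  first {_ ∷ _} _    (eq ∷ _) = here eq

  exact : Any (λ s → ∣ s ∣ ≡ n) (edges H)
  exact = dedup (Anyₚ.++⁺ˡ (first len sizes))

  not-colourable : ¬ TwoColourable H
  not-colourable (f , proper) = Allₚ.All¬⇒¬Any proper (dedup (Any.map monochromatic fitting))
    where
    c = Vec.tabulate f
    monochromatic : ∀ {s} → Fits c s → Monochromatic H f s
    monochromatic {s} (b , fit) = b , λ v v∈s → trans (sym (Vecₚ.lookup∘tabulate f v)) (fits⇒constant b c s fit v v∈s)
    fitting : Any (Fits c) all-edges
    fitting = Sum.[ Anyₚ.++⁺ˡ , (λ c∈ → Anyₚ.++⁺ʳ es (Anyₚ.map⁺ (Any.map (λ { refl → proj₁ (majority h c) , class-fits _ c }) c∈))) ]′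
      (covers (∈-colourings c))

  open ≤-Reasoning

  rest-weight : ι (length rest) * pow ½ h ≤ 1ℚ
  rest-weight = begin
    ι (length rest) * pow ½ h                ≤⟨ *-monoˡ (pow ½ h) (0≤pow h 0≤½) bound ⟩
    pow (1ℚ - x) m * ι N * pow ½ h
      ≤⟨ *-monoˡ (pow ½ h) (0≤pow h 0≤½) (*-monoˡ (ι N) (0≤ι N) few) ⟩
    pow ½ h * ι N * pow ½ h
      -- One factor `pow ½ h` is the fraction of colourings left, the other the weight of a majority
      -- class; together they cancel the number of colourings.
      ≡⟨ solve 2 (λ p n → (p :* n) :* p := (p :* p) :* n) refl (pow ½ h) (ι N) ⟩
    pow ½ h * pow ½ h * ι N                  ≡⟨ cong (λ z → z * ι N) (^-homo-* ½ h h) ⟨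
    pow ½ (h ℕ.+ h) * ι N                    ≡⟨ colourings-count (h ℕ.+ h) ⟩
    1ℚ                                       ∎
    where N = length (colourings (h ℕ.+ h))

  weight-bound : weight H ≤ ι m * pow ½ n + 1ℚ
  weight-bound = begin
    edgeWeight (deduplicate _≟ₛ_ all-edges)
      ≤⟨ edgeWeight-deduplicate all-edges ⟩
    edgeWeight (es ++ map (majority-class h) rest)
      ≡⟨ edgeWeight-++ es (map (majority-class h) rest) ⟩
    edgeWeight es + edgeWeight (map (majority-class h) rest)
      ≤⟨ +-mono-≤ (edgeWeight-≤ (All.map (λ eq → ℕₚ.≤-reflexive (sym eq)) sizes)) (edgeWeight-≤ rest-sizes) ⟩
    ι (length es) * pow ½ n + ι (length (map (majority-class h) rest)) * pow ½ h
      ≡⟨ cong₂ (λ k l → ι k * pow ½ n + ι l * pow ½ h) len (Listₚ.length-map (majority-class h) rest) ⟩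
    ι m * pow ½ n + ι (length rest) * pow ½ h
      ≤⟨ +-monoʳ-≤ (ι m * pow ½ n) rest-weight ⟩
    ι m * pow ½ n + 1ℚ                                             ∎

-- Bounding C(2h,n)/C(h,n) by 2^n e.

binom-absorb-ι : ∀ n k → ι (suc k) * ι (binom n (suc k)) ≡ (ι n - ι k) * ι (binom n k)
binom-absorb-ι n k = begin
  s * b′
    ≡⟨ solve 3 (λ s b k → s := (s :+ k :* b) :- k :* b) refl (s * b′) b (ι k) ⟩
  (s * b′ + ι k * b) - ι k * b
    ≡⟨ cong (λ z → z - ι k * b) (cong₂ _+_ (ι-* (suc k) (binom n (suc k))) (ι-* k (binom n k))) ⟨
  (ι (suc k ℕ.* binom n (suc k)) + ι (k ℕ.* binom n k)) - ι k * b
    ≡⟨ cong (λ z → z - ι k * b) (trans (sym (ι-+ (suc k ℕ.* binom n (suc k)) (k ℕ.* binom n k)))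
         (trans (cong ι (binom-absorb n k)) (ι-* n (binom n k)))) ⟩
  ι n * b - ι k * b
    ≡⟨ solve 3 (λ n k b → n :* b :- k :* b := (n :- k) :* b) refl (ι n) (ι k) b ⟩
  (ι n - ι k) * b                      ∎
  where
  open ≡-Reasoning
  s = ι (suc k)
  b = ι (binom n k)
  b′ = ι (binom n (suc k))

-- The product of 1 + iy over i < k: the correction to 2^k in the ratio C(2h,k)/C(h,k). `risingSum`
-- is the exponent that bounds it.
rising : ℚ → ℕ → ℚ
rising y zero    = 1ℚ
rising y (suc k) = rising y k * (1ℚ + ι k * y)

risingSum : ℚ → ℕ → ℚ
risingSum y zero    = 0ℚ
risingSum y (suc k) = risingSum y k + ι k * y

module _ {y : ℚ} (0≤y : 0ℚ ≤ y) where
  open ≤-Reasoning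

  0≤risingSum : ∀ k → 0ℚ ≤ risingSum y k
  0≤risingSum zero    = ≤-refl
  0≤risingSum (suc k) = 0≤+ (0≤risingSum k) (0≤* (0≤ι k) 0≤y)

  0≤rising : ∀ k → 0ℚ ≤ rising y k
  0≤rising zero    = 0≤1
  0≤rising (suc k) = 0≤* (0≤rising k) (0≤+ 0≤1 (0≤* (0≤ι k) 0≤y))

  rising≤expSum : ∀ k → rising y k ≤ expSum (risingSum y k) (suc k)
  rising≤expSum zero    = ≤-refl
  rising≤expSum (suc k) = begin
    rising y k * (1ℚ + ι k * y)
      ≤⟨ *-monoˡ (1ℚ + ι k * y) (0≤+ 0≤1 (0≤* (0≤ι k) 0≤y)) (rising≤expSum k) ⟩
    expSum (risingSum y k) (suc k) * (1ℚ + ι k * y)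
      ≤⟨ expSum-*-1+x (0≤risingSum k) (0≤* (0≤ι k) 0≤y) (suc k) ⟩
    expSum (risingSum y k + ι k * y) (suc (suc k))          ∎

  -- Gauss's sum 2(0 + 1 + ... + (k-1)) = k² - k, scaled by `y` and free of subtraction.
  2*risingSum : ∀ k → risingSum y k + risingSum y k + ι k * y ≡ ι k * ι k * y
  2*risingSum zero    = solve 1 (λ y → con 0ℚ :+ con 0ℚ :+ con 0ℚ :* y := con 0ℚ :* con 0ℚ :* y)
      refl y
  2*risingSum (suc k) = begin-equality
    (t + n * y) + (t + n * y) + (1ℚ + n) * y
      ≡⟨ solve 3 (λ t n y → (t :+ n :* y) :+ (t :+ n :* y) :+ (con 1ℚ :+ n) :* y := (t :+ t :+ n :* y) :+ (n :+ n :+ con 1ℚ) :* y)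
          refl t n y ⟩
    (t + t + n * y) + (n + n + 1ℚ) * y
      ≡⟨ cong (λ z → z + (n + n + 1ℚ) * y) (2*risingSum k) ⟩
    n * n * y + (n + n + 1ℚ) * y
      ≡⟨ solve 2 (λ n y → n :* n :* y :+ (n :+ n :+ con 1ℚ) :* y := (con 1ℚ :+ n) :* (con 1ℚ :+ n) :* y)
          refl n y ⟩
    (1ℚ + n) * (1ℚ + n) * y ∎
    where t = risingSum y k
          n = ι k

  risingSum≤1 : ∀ k → ι k * ι k * y ≤ 2ℚ → risingSum y k ≤ 1ℚ
  risingSum≤1 k k²y≤2 = *-cancelˡ-≤-pos 2ℚ (begin
    2ℚ * t              ≡⟨ solve 1 (λ t → con 2ℚ :* t := t :+ t) refl t ⟩
    t + t               ≤⟨ p≤p+q (t + t) (0≤* (0≤ι k) 0≤y) ⟩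
    t + t + ι k * y     ≡⟨ 2*risingSum k ⟩
    ι k * ι k * y       ≤⟨ k²y≤2 ⟩
    2ℚ                  ≡⟨⟩
    2ℚ * 1ℚ             ∎)
    where t = risingSum y k

-- Here y = 1/(2g): for k < n the factor (2h-k)/(h-k) is at most 2(1+ky).
binom-ratio : ∀ g n {y} → 0ℚ ≤ y → ι g * y ≡ ½ → ∀ k → k ℕ.≤ n →
  pow ½ k * ι (binom ((g ℕ.+ n) ℕ.+ (g ℕ.+ n)) k) ≤ ι (binom (g ℕ.+ n) k) * rising y k
binom-ratio g n {y} 0≤y gy≡½ zero    k≤n = ≤-refl
binom-ratio g n {y} 0≤y gy≡½ (suc k) k<n = *-cancelˡ-≤-pos s {{positive (0<ι (suc k))}} (begin
  s * (½ * pow ½ k * ι (binom (h ℕ.+ h) (suc k)))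
    ≡⟨ solve 3 (λ s p b → s :* (con ½ :* p :* b) := con ½ :* p :* (s :* b))
        refl s (pow ½ k) (ι (binom (h ℕ.+ h) (suc k))) ⟩
  ½ * pow ½ k * (s * ι (binom (h ℕ.+ h) (suc k)))
    ≡⟨ cong (λ z → ½ * pow ½ k * z) (trans (binom-absorb-ι (h ℕ.+ h) k) (cong (λ z → (z - ι k) * ι (binom (h ℕ.+ h) k)) (ι-+ h h))) ⟩
  ½ * pow ½ k * ((ι h + ι h - ι k) * ι (binom (h ℕ.+ h) k))
    ≡⟨ solve 3 (λ p d b → con ½ :* p :* (d :* b) := con ½ :* d :* (p :* b))
        refl (pow ½ k) (ι h + ι h - ι k) (ι (binom (h ℕ.+ h) k)) ⟩
  ½ * (ι h + ι h - ι k) * (pow ½ k * ι (binom (h ℕ.+ h) k))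
    ≤⟨ *-mono 0≤factor (0≤* (0≤ι (binom h k)) (0≤rising 0≤y k)) factor (binom-ratio g n 0≤y gy≡½ k (ℕₚ.<⇒≤ k<n)) ⟩
  (ι h - ι k) * (1ℚ + ι k * y) * (ι (binom h k) * rising y k)
    ≡⟨ solve 4 (λ d f b r → d :* f :* (b :* r) := (d :* b) :* (r :* f))
        refl (ι h - ι k) (1ℚ + ι k * y) (ι (binom h k)) (rising y k) ⟩
  (ι h - ι k) * ι (binom h k) * rising y (suc k)
    ≡⟨ cong (λ z → z * rising y (suc k)) (binom-absorb-ι h k) ⟨
  s * ι (binom h (suc k)) * rising y (suc k)
    ≡⟨ *-assoc s (ι (binom h (suc k))) (rising y (suc k)) ⟩
  s * (ι (binom h (suc k)) * rising y (suc k)) ∎)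
  where
  open ≤-Reasoning
  h = g ℕ.+ n
  s = ι (suc k)
  g≤h-k : ι g ≤ ι h - ι k
  g≤h-k = begin
    ι g                  ≡⟨ solve 2 (λ g k → g := g :+ k :- k) refl (ι g) (ι k) ⟩
    ι g + ι k - ι k      ≡⟨ cong (λ z → z - ι k) (ι-+ g k) ⟨
    ι (g ℕ.+ k) - ι k    ≤⟨ +-monoˡ-≤ (- ι k) (ι-mono (ℕₚ.+-monoʳ-≤ g (ℕₚ.<⇒≤ k<n))) ⟩
    ι h - ι k            ∎
  split : ½ * (ι h + ι h - ι k) ≡ (ι h - ι k) + ι k * ½
  split = solve 2 (λ h k → con ½ :* (h :+ h :- k) := (h :- k) :+ k :* con ½) refl (ι h) (ι k)
  0≤factor : 0ℚ ≤ ½ * (ι h + ι h - ι k)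
  0≤factor = subst (0ℚ ≤_) (sym split) (0≤+ (≤-trans (0≤ι g) g≤h-k) (0≤* (0≤ι k) 0≤½))
  -- Half of 2h - k exceeds h - k by k/2, which is k g y because g y = 1/2. Replacing g by the
  -- larger h - k produces the factor 1 + ky; this is where h = g + n is used.
  factor : ½ * (ι h + ι h - ι k) ≤ (ι h - ι k) * (1ℚ + ι k * y)
  factor = begin
    ½ * (ι h + ι h - ι k)                  ≡⟨ split ⟩
    (ι h - ι k) + ι k * ½                  ≡⟨ cong (λ z → (ι h - ι k) + ι k * z) gy≡½ ⟨
    (ι h - ι k) + ι k * (ι g * y)
      ≤⟨ +-monoʳ-≤ (ι h - ι k) (*-monoʳ (ι k) (0≤ι k) (*-monoˡ y 0≤y g≤h-k)) ⟩
    (ι h - ι k) + ι k * ((ι h - ι k) * y)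
      ≡⟨ solve 3 (λ d k y → d :+ k :* (d :* y) := d :* (con 1ℚ :+ k :* y))
          refl (ι h - ι k) (ι k) y ⟩
    (ι h - ι k) * (1ℚ + ι k * y)           ∎

-- Choice of the parameters, given upper estimates of e and ln 2.

4ℚ : ℚ
4ℚ = + 4 / 1

⅛ : ℚ
⅛ = + 1 / 8

module _ {e₁ : ℚ} (expSum≤e₁ : ∀ N → expSum 1ℚ N ≤ e₁) where
  open ≤-Reasoning

  1≤e₁ : 1ℚ ≤ e₁
  1≤e₁ = expSum≤e₁ 1

  -- With y = 1/(2g) the exponent is n(n-1)/(4g), at most 1 because n² ≤ 4g. Hence the product of
  -- corrections stays below e.
  binom-bound : ∀ g n → 1 ℕ.≤ g → n ℕ.* n ℕ.≤ 4 ℕ.* g →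
    pow ½ n * ι (binom ((g ℕ.+ n) ℕ.+ (g ℕ.+ n)) n) ≤ ι (binom (g ℕ.+ n) n) * e₁
  binom-bound g n 1≤g n²≤4g = begin
    pow ½ n * ι (binom ((g ℕ.+ n) ℕ.+ (g ℕ.+ n)) n)   ≤⟨ binom-ratio g n 0≤y gy≡½ n ℕₚ.≤-refl ⟩
    ι (binom (g ℕ.+ n) n) * rising y n
      ≤⟨ *-monoʳ (ι (binom (g ℕ.+ n) n)) (0≤ι (binom (g ℕ.+ n) n)) rising≤e₁ ⟩
    ι (binom (g ℕ.+ n) n) * e₁                        ∎
    where
    1/g = inverse (0<ι g {{ℕ.>-nonZero 1≤g}})
    y = ½ * proj₁ 1/g
    0≤y : 0ℚ ≤ y
    0≤y = 0≤* 0≤½ (<⇒≤ (proj₁ (proj₂ 1/g)))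
    gy≡½ : ι g * y ≡ ½
    gy≡½ = begin-equality
      ι g * (½ * proj₁ 1/g)
        ≡⟨ solve 2 (λ g r → g :* (con ½ :* r) := con ½ :* (g :* r)) refl (ι g) (proj₁ 1/g) ⟩
      ½ * (ι g * proj₁ 1/g)   ≡⟨ cong (λ z → ½ * z) (proj₂ (proj₂ 1/g)) ⟩
      ½ * 1ℚ                  ≡⟨⟩
      ½                       ∎
    n²y≤2 : ι n * ι n * y ≤ 2ℚ
    n²y≤2 = begin
      ι n * ι n * y      ≡⟨ cong (λ z → z * y) (ι-* n n) ⟨
      ι (n ℕ.* n) * y    ≤⟨ *-monoˡ y 0≤y (ι-mono n²≤4g) ⟩
      ι (4 ℕ.* g) * y    ≡⟨ cong (λ z → z * y) (ι-* 4 g) ⟩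
      4ℚ * ι g * y       ≡⟨ *-assoc 4ℚ (ι g) y ⟩
      4ℚ * (ι g * y)     ≡⟨ cong (λ z → 4ℚ * z) gy≡½ ⟩
      4ℚ * ½             ≡⟨⟩
      2ℚ                 ∎
    rising≤e₁ : rising y n ≤ e₁
    rising≤e₁ = begin
      rising y n                        ≤⟨ rising≤expSum 0≤y n ⟩
      expSum (risingSum y n) (suc n)
        ≤⟨ expSum-mono (suc n) (0≤risingSum 0≤y n) (risingSum≤1 0≤y n n²y≤2) ⟩
      expSum 1ℚ (suc n)                 ≤⟨ expSum≤e₁ (suc n) ⟩
      e₁                                ∎

  -- `M` rounds halve the number of surviving colourings, so `M * h` rounds reduce it from 2^(2h) to
  -- 2^h. An edge weighs 2^(-n) and M is about l e₁ 2^(n-1), which gives the main term h l e₁ / 2.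
  light-obstruction : ∀ {l} → 0ℚ ≤ l → fromℚ 2ℚ ≤ʳ exp l → ∀ g n → 2 ℕ.≤ n → 1 ℕ.≤ g → n ℕ.* n ℕ.≤ 4 ℕ.* g →
    ∃[ H ] (¬ TwoColourable H × SmallestEdge H n ×
            weight H ≤ ι (g ℕ.+ n) * (l * e₁ * ½ + pow ½ n) + 1ℚ)
  light-obstruction {l} 0≤l 2≤exp g n 2≤n 1≤g n²≤4g =
    let (H , ¬col , smallest , light) = sparse-obstruction {h = h} {m = M ℕ.* h} 2≤n (ℕₚ.m≤n+m n g) 1≤m x≤1 x-bound few
    in H , ¬col , smallest , ≤-trans light (+-monoˡ-≤ 1ℚ count)
    where
    h = g ℕ.+ n
    P = pow ½ n
    1/e₁ = inverse (<-≤-trans (positive⁻¹ 1ℚ) 1≤e₁)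
    w = proj₁ 1/e₁
    0≤w : 0ℚ ≤ w
    0≤w = <⇒≤ (proj₁ (proj₂ 1/e₁))
    e₁w≡1 : e₁ * w ≡ 1ℚ
    e₁w≡1 = proj₂ (proj₂ 1/e₁)
    0≤P : 0ℚ ≤ P
    0≤P = 0≤pow n 0≤½
    -- Since `w` is 1/e₁, this is 2^(1-n)/e₁, at most 2 C(h,n) / C(2h,n) by `binom-bound`.
    x = 2ℚ * P * w
    0≤2ℚ : 0ℚ ≤ 2ℚ
    0≤2ℚ = nonNegative⁻¹ 2ℚ
    0≤x : 0ℚ ≤ x
    0≤x = 0≤* (0≤* 0≤2ℚ 0≤P) 0≤w
    x≤1 : x ≤ 1ℚ
    x≤1 = begin
      2ℚ * P * w
        ≤⟨ *-monoˡ w 0≤w (*-monoʳ 2ℚ 0≤2ℚ (pow-½-antimono {1} (ℕₚ.≤-trans (s≤s z≤n) 2≤n))) ⟩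
      2ℚ * (½ * 1ℚ) * w     ≡⟨⟩
      1ℚ * w                ≤⟨ *-monoˡ w 0≤w 1≤e₁ ⟩
      e₁ * w                ≡⟨ e₁w≡1 ⟩
      1ℚ                    ∎
    x-bound : x * ι (binom (h ℕ.+ h) n) ≤ ι (binom h n ℕ.+ binom h n)
    x-bound = begin
      2ℚ * P * w * ι (binom (h ℕ.+ h) n)
        ≡⟨ solve 3 (λ p w b → con 2ℚ :* p :* w :* b := con 2ℚ :* w :* (p :* b))
            refl P w (ι (binom (h ℕ.+ h) n)) ⟩
      2ℚ * w * (P * ι (binom (h ℕ.+ h) n))
        ≤⟨ *-monoʳ (2ℚ * w) (0≤* 0≤2ℚ 0≤w) (binom-bound g n 1≤g n²≤4g) ⟩
      2ℚ * w * (b * e₁)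
        ≡⟨ solve 3 (λ w b e → con 2ℚ :* w :* (b :* e) := (b :+ b) :* (e :* w)) refl w b e₁ ⟩
      (b + b) * (e₁ * w)                     ≡⟨ cong (λ z → (b + b) * z) e₁w≡1 ⟩
      (b + b) * 1ℚ                           ≡⟨ *-identityʳ (b + b) ⟩
      b + b                                  ≡⟨ ι-+ (binom h n) (binom h n) ⟨
      ι (binom h n ℕ.+ binom h n)            ∎
      where b = ι (binom h n)
    Q = pow 2ℚ n
    QP≡1 : Q * P ≡ 1ℚ
    QP≡1 = trans (sym (^-distrib-* 2ℚ ½ n)) (pow-1 n)
    -- This is l/x, written without dividing by `x`.
    r = l * e₁ * ½ * Q
    0≤r : 0ℚ ≤ r
    0≤r = 0≤* (0≤* (0≤* 0≤l (≤-trans 0≤1 1≤e₁)) 0≤½) (0≤pow n 0≤2ℚ)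
    M = proj₁ (ceiling r 0≤r)
    l≤Mx : l ≤ ι M * x
    l≤Mx = begin
      l                                ≡⟨ *-identityʳ l ⟨
      l * 1ℚ                           ≡⟨ cong₂ (λ y z → l * (y * z)) e₁w≡1 QP≡1 ⟨
      l * ((e₁ * w) * (Q * P))
        ≡⟨ solve 5 (λ l e w q p → l :* ((e :* w) :* (q :* p)) := l :* e :* con ½ :* q :* (con 2ℚ :* p :* w))
            refl l e₁ w Q P ⟩
      r * x                            ≤⟨ *-monoˡ x 0≤x (proj₁ (proj₂ (ceiling r 0≤r))) ⟩
      ι M * x                          ∎
    halved : ∀ k → l ≤ ι k * x → pow (1ℚ - x) k ≤ ½
    halved = pow-≤-½ 2≤exp 0≤l 0≤x x≤1
    1≤M : ∀ k → l ≤ ι k * x → 1 ℕ.≤ k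
    -- With no rounds at all, halving would read 1 ≤ 1/2.
    1≤M zero    l≤0 = contradiction (<-≤-trans (from-yes (½ <? 1ℚ)) (halved zero l≤0)) (<-irrefl refl)
    1≤M (suc k) _   = s≤s z≤n
    1≤m : 1 ℕ.≤ M ℕ.* h
    1≤m = ℕₚ.*-mono-≤ (1≤M M l≤Mx) (ℕₚ.≤-trans 1≤g (ℕₚ.m≤m+n g n))
    few : pow (1ℚ - x) (M ℕ.* h) ≤ pow ½ h
    few = begin
      pow (1ℚ - x) (M ℕ.* h)       ≡⟨ ^-assocʳ (1ℚ - x) M h ⟨
      pow (pow (1ℚ - x) M) h       ≤⟨ pow-mono h (0≤pow M (p≤q⇒0≤q-p x≤1)) (halved M l≤Mx) ⟩
      pow ½ h                      ∎
    -- Rounding `r` up to `M` adds at most one edge per halving, hence the summand `P`.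
    count : ι (M ℕ.* h) * P ≤ ι h * (l * e₁ * ½ + P)
    count = begin
      ι (M ℕ.* h) * P
        ≡⟨ cong (λ z → z * P) (trans (ι-* M h) (*-comm (ι M) (ι h))) ⟩
      ι h * ι M * P
        ≤⟨ *-monoˡ P 0≤P (*-monoʳ (ι h) (0≤ι h) (proj₂ (proj₂ (ceiling r 0≤r)))) ⟩
      ι h * (r + 1ℚ) * P
        ≡⟨ solve 4 (λ h c q p → h :* (c :* q :+ con 1ℚ) :* p := h :* (c :* (q :* p) :+ p))
            refl (ι h) (l * e₁ * ½) Q P ⟩
      ι h * (l * e₁ * ½ * (Q * P) + P)
        ≡⟨ cong (λ z → ι h * (z + P)) (trans (cong (λ z → l * e₁ * ½ * z) QP≡1) (*-identityʳ (l * e₁ * ½))) ⟩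
      ι h * (l * e₁ * ½ + P)                   ∎

-- Absorbing the lower-order terms.

-- For l ≤ 1, a single round with x = l gives 1 - l ≤ 1/2. The bound makes terms without the factor
-- `l * e₁` comparable with it, whatever `l` and `e₁` are.
½≤ln2 : ∀ {l} → 0ℚ ≤ l → fromℚ 2ℚ ≤ʳ exp l → ½ ≤ l
½≤ln2 {l} 0≤l 2≤exp with ≤-total l 1ℚ
... | inj₂ 1≤l = ≤-trans (≤ᵇ⇒≤ _) 1≤l
... | inj₁ l≤1 = begin
  ½                         ≡⟨⟩
  1ℚ - ½                    ≤⟨ +-monoʳ-≤ 1ℚ (neg-antimono-≤ (pow-≤-½ 2≤exp 0≤l 0≤l l≤1 1 l≤1l)) ⟩
  1ℚ - (1ℚ - l) * 1ℚ        ≡⟨ solve 1 (λ l → con 1ℚ :- (con 1ℚ :- l) :* con 1ℚ := l) refl l ⟩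
  l                         ∎
  where
  open ≤-Reasoning
  l≤1l : l ≤ ι 1 * l
  l≤1l = ≤-reflexive (sym (*-identityˡ l))

n*pow½≤1 : ∀ n → ι n * pow ½ n ≤ 1ℚ
n*pow½≤1 zero    = ≤ᵇ⇒≤ _
n*pow½≤1 (suc n) = begin
  (1ℚ + ι n) * (½ * pow ½ n)
    ≡⟨ solve 2 (λ n p → (con 1ℚ :+ n) :* (con ½ :* p) := con ½ :* (n :* p) :+ con ½ :* p)
        refl (ι n) (pow ½ n) ⟩
  ½ * (ι n * pow ½ n) + ½ * pow ½ n
    ≤⟨ +-mono-≤ (*-monoʳ ½ 0≤½ (n*pow½≤1 n)) (*-monoʳ ½ 0≤½ (pow-½-antimono {0} {n} z≤n)) ⟩
  ½ * 1ℚ + ½ * 1ℚ                       ≡⟨⟩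
  1ℚ                                    ∎
  where open ≤-Reasoning

-- Taking floor(m/4) + 1 makes `g` positive; the excess of 4g over m = n² is at most 4 and so of
-- lower order.
quarter : ∀ m → ∃[ g ] (1 ℕ.≤ g × m ℕ.≤ 4 ℕ.* g × 4 ℕ.* g ℕ.≤ m ℕ.+ 4)
quarter m = suc k , s≤s z≤n , (begin
    m                       ≡⟨ ℕ.m≡m%n+[m/n]*n m 4 ⟩
    m ℕ.% 4 ℕ.+ k ℕ.* 4     ≤⟨ ℕₚ.+-monoˡ-≤ (k ℕ.* 4) (ℕₚ.<⇒≤ (ℕ.m%n<n m 4)) ⟩
    suc k ℕ.* 4             ≡⟨ ℕₚ.*-comm (suc k) 4 ⟩
    4 ℕ.* suc k             ∎) , (begin
    4 ℕ.* suc k             ≡⟨ ℕₚ.*-comm 4 (suc k) ⟩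
    4 ℕ.+ k ℕ.* 4           ≡⟨ ℕₚ.+-comm 4 (k ℕ.* 4) ⟩
    k ℕ.* 4 ℕ.+ 4           ≤⟨ ℕₚ.+-monoˡ-≤ 4 (ℕ.m/n*n≤m m 4) ⟩
    m ℕ.+ 4                 ∎)
  where
  open ℕₚ.≤-Reasoning
  k = m ℕ./ 4

module _ {ε c : ℚ} (½≤c : ½ ≤ c) {n h : ℕ} (4≤n : 4 ℕ.≤ n) (40≤εn : ι 40 ≤ ε * ι n)
  (4h≤ : 4 ℕ.* h ℕ.≤ n ℕ.* n ℕ.+ 4 ℕ.+ 4 ℕ.* n) where
  open ≤-Reasoning
  private
    N = ι n
    1≤N : 1ℚ ≤ N
    1≤N = ι-mono {1} (ℕₚ.≤-trans (s≤s z≤n) 4≤n)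
    0≤N : 0ℚ ≤ N
    0≤N = 0≤ι n
    0≤c : 0ℚ ≤ c
    0≤c = ≤-trans 0≤½ ½≤c
    0≤⅛ : 0ℚ ≤ ⅛
    0≤⅛ = nonNegative⁻¹ ⅛

    4h≤ℚ : 4ℚ * ι h ≤ N * N + 4ℚ + 4ℚ * N
    4h≤ℚ = begin
      4ℚ * ι h                                ≡⟨ ι-* 4 h ⟨
      ι (4 ℕ.* h)                             ≤⟨ ι-mono 4h≤ ⟩
      ι (n ℕ.* n ℕ.+ 4 ℕ.+ 4 ℕ.* n)
        ≡⟨ trans (ι-+ (n ℕ.* n ℕ.+ 4) (4 ℕ.* n)) (cong₂ _+_ (ι-+ (n ℕ.* n) 4) (ι-* 4 n)) ⟩
      ι (n ℕ.* n) + 4ℚ + 4ℚ * N               ≡⟨ cong (λ z → z + 4ℚ + 4ℚ * N) (ι-* n n) ⟩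
      N * N + 4ℚ + 4ℚ * N                     ∎

    h≤n² : h ℕ.≤ n ℕ.* n
    h≤n² = ℕₚ.*-cancelˡ-≤ 4 (ℕₚ.≤-trans 4h≤ bound)
      where
      m≤n² : ∀ {m} → m ℕ.≤ n → 4 ℕ.* m ℕ.≤ n ℕ.* n
      m≤n² m≤n = ℕₚ.*-mono-≤ 4≤n m≤n
      bound : n ℕ.* n ℕ.+ 4 ℕ.+ 4 ℕ.* n ℕ.≤ 4 ℕ.* (n ℕ.* n)
      bound = ℕₚ.≤-trans
        (ℕₚ.+-mono-≤ (ℕₚ.+-monoʳ-≤ (n ℕ.* n) (m≤n² {1} (ℕₚ.≤-trans (s≤s z≤n) 4≤n))) (m≤n² ℕₚ.≤-refl))
        (ℕₚ.≤-trans (ℕₚ.m≤m+n (n ℕ.* n ℕ.+ n ℕ.* n ℕ.+ n ℕ.* n) (n ℕ.* n)) (ℕₚ.≤-reflexive (four (n ℕ.* n))))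
        where
        four : ∀ a → a ℕ.+ a ℕ.+ a ℕ.+ a ≡ 4 ℕ.* a
        four a = trans (cong (λ z → a ℕ.+ a ℕ.+ a ℕ.+ z) (sym (ℕₚ.+-identityʳ a)))
          (trans (ℕₚ.+-assoc (a ℕ.+ a) a (a ℕ.+ 0)) (ℕₚ.+-assoc a a (a ℕ.+ (a ℕ.+ 0))))

    h*pow½≤N : ι h * pow ½ n ≤ N
    h*pow½≤N = begin
      ι h * pow ½ n             ≤⟨ *-monoˡ (pow ½ n) (0≤pow n 0≤½) (ι-mono h≤n²) ⟩
      ι (n ℕ.* n) * pow ½ n     ≡⟨ cong (λ z → z * pow ½ n) (ι-* n n) ⟩
      N * N * pow ½ n           ≡⟨ *-assoc N N (pow ½ n) ⟩
      N * (N * pow ½ n)         ≤⟨ *-monoʳ N 0≤N (n*pow½≤1 n) ⟩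
      N * 1ℚ                    ≡⟨ *-identityʳ N ⟩
      N                         ∎

  -- Here `c` is `l * e₁`. Beyond c n²/8, the shift of h by n costs cn/2, the rounding in `quarter`
  -- costs c/2 ≤ cn/2, and h 2^(-n) + 1 ≤ 2n ≤ 4cn. The sum 5cn is (c/8) times 40n, which is where
  -- 40 comes from.
  weight-estimate : ι h * (c * ½ + pow ½ n) + 1ℚ ≤ (1ℚ + ε) * (c * ⅛) * (N * N)
  weight-estimate = begin
    ι h * (c * ½ + pow ½ n) + 1ℚ
      ≡⟨ solve 3 (λ h c p → h :* (c :* con ½ :+ p) :+ con 1ℚ := c :* con ⅛ :* (con 4ℚ :* h) :+ (h :* p :+ con 1ℚ))
          refl (ι h) c (pow ½ n) ⟩
    c * ⅛ * (4ℚ * ι h) + (ι h * pow ½ n + 1ℚ)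
      ≤⟨ +-mono-≤ (*-monoʳ (c * ⅛) (0≤* 0≤c 0≤⅛) 4h≤ℚ) (+-mono-≤ h*pow½≤N 1≤N) ⟩
    c * ⅛ * (N * N + 4ℚ + 4ℚ * N) + (N + N)
      ≡⟨ solve 2 (λ c n → c :* con ⅛ :* (n :* n :+ con 4ℚ :+ con 4ℚ :* n) :+ (n :+ n)
           := c :* con ⅛ :* (n :* n :+ con 4ℚ :* n) :+ (c :* con ½ :* con 1ℚ :+ con ½ :* (con 4ℚ :* n))) refl c N ⟩
    c * ⅛ * (N * N + 4ℚ * N) + (c * ½ * 1ℚ + ½ * (4ℚ * N))
      ≤⟨ +-monoʳ-≤ (c * ⅛ * (N * N + 4ℚ * N)) (+-mono-≤ (*-monoʳ (c * ½) (0≤* 0≤c 0≤½) 1≤N)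
           (*-monoˡ (4ℚ * N) (0≤* (nonNegative⁻¹ 4ℚ) 0≤N) ½≤c)) ⟩
    c * ⅛ * (N * N + 4ℚ * N) + (c * ½ * N + c * (4ℚ * N))
      ≡⟨ solve 2 (λ c n → c :* con ⅛ :* (n :* n :+ con 4ℚ :* n) :+ (c :* con ½ :* n :+ c :* (con 4ℚ :* n))
           := c :* con ⅛ :* (n :* n) :+ c :* con ⅛ :* n :* con (ι 40)) refl c N ⟩
    c * ⅛ * (N * N) + c * ⅛ * N * ι 40
      ≤⟨ +-monoʳ-≤ (c * ⅛ * (N * N)) (*-monoʳ (c * ⅛ * N) (0≤* (0≤* 0≤c 0≤⅛) 0≤N) 40≤εn) ⟩
    c * ⅛ * (N * N) + c * ⅛ * N * (ε * N)
      ≡⟨ solve 3 (λ e c n → c :* con ⅛ :* (n :* n) :+ c :* con ⅛ :* n :* (e :* n) := (con 1ℚ :+ e) :* (c :* con ⅛) :* (n :* n))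
          refl ε c N ⟩
    (1ℚ + ε) * (c * ⅛) * (N * N) ∎

-- Reading off the estimates of e and ln 2; conclusion.

-- A rational above a product of cuts carries rationals above every factor, and those above e and ln
-- 2 carry `e₁` and `l` inside them. Monotonicity then discards all intermediate slack.
product-cut : ∀ {ε n s} → 0ℚ < ε →
  (fromℚ (1ℚ + ε) *ʳ (e *ʳ ln (+ 2 / 1) *ʳ fromℚ (+ 1 / 8)) *ʳ fromℕ (n ℕ.^ 2)) <ʳ s →
  ∃[ e₁ ] ∃[ l ] ((∀ N → expSum 1ℚ N ≤ e₁) × 0ℚ ≤ l × (fromℚ 2ℚ ≤ʳ exp l)
    × (1ℚ + ε) * (l * e₁ * ⅛) * (ι n * ι n) < s)
product-cut {ε} {n} {s} 0<ε
  (_ , _ , (a₁ , b₁ ,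
    (_ , _ , (a₂ , b₂ , (r₁ , _ , 1+ε≤r₁ , r₁<a₂) ,
      (_ , _ , (a₃ , b₃ ,
        (_ , _ , (a₄ , b₄ , (e₁ , 0≤e₁ , partial , e₁<a₄) , (l , 0≤l , 2≤exp , l<b₄) , refl) , p₄<a₃) ,
        (r₂ , _ , ⅛≤r₂ , r₂<b₃) , refl) , p₃<b₂) , refl) , p₂<a₁) ,
    (r₃ , _ , n²≤r₃ , r₃<b₁) , refl) , p<s) =
  e₁ , l , partial , 0≤l , 2≤exp , (begin-strict
    (1ℚ + ε) * (l * e₁ * ⅛) * (ι n * ι n)
      ≤⟨ *-mono (0≤* 0≤1+ε (0≤* (0≤* 0≤l 0≤e₁) 0≤⅛)) 0≤b₁ step₂ n²≤b₁ ⟩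
    a₁ * b₁                                 <⟨ p<s ⟩
    s                                       ∎)
  where
  open ≤-Reasoning
  0≤1+ε : 0ℚ ≤ 1ℚ + ε
  0≤1+ε = 0≤+ 0≤1 (<⇒≤ 0<ε)
  0≤⅛ : 0ℚ ≤ ⅛
  0≤⅛ = nonNegative⁻¹ ⅛
  n²≤b₁ : ι n * ι n ≤ b₁
  n²≤b₁ = begin
    ι n * ι n           ≡⟨ ι-* n n ⟨
    ι (n ℕ.* n)         ≡⟨ cong (λ z → ι (n ℕ.* z)) (ℕₚ.*-identityʳ n) ⟨
    ι (n ℕ.^ 2)         ≡⟨ ι≡/ (n ℕ.^ 2) ⟩
    + (n ℕ.^ 2) / 1     ≤⟨ n²≤r₃ ⟩
    r₃                  <⟨ r₃<b₁ ⟩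
    b₁                  ∎
  0≤b₁ : 0ℚ ≤ b₁
  0≤b₁ = ≤-trans (0≤* (0≤ι n) (0≤ι n)) n²≤b₁
  step₄ : l * e₁ ≤ a₃
  step₄ = begin
    l * e₁     ≡⟨ *-comm l e₁ ⟩
    e₁ * l     ≤⟨ *-mono 0≤e₁ (≤-trans 0≤l (<⇒≤ l<b₄)) (<⇒≤ e₁<a₄) (<⇒≤ l<b₄) ⟩
    a₄ * b₄    <⟨ p₄<a₃ ⟩
    a₃         ∎
  ⅛≤b₃ : ⅛ ≤ b₃
  ⅛≤b₃ = ≤-trans ⅛≤r₂ (<⇒≤ r₂<b₃)
  step₃ : l * e₁ * ⅛ ≤ b₂
  step₃ = ≤-trans (*-mono (0≤* 0≤l 0≤e₁) (≤-trans 0≤⅛ ⅛≤b₃) step₄ ⅛≤b₃) (<⇒≤ p₃<b₂)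
  step₂ : (1ℚ + ε) * (l * e₁ * ⅛) ≤ a₁
  step₂ = ≤-trans (*-mono 0≤1+ε (≤-trans (0≤* (0≤* 0≤l 0≤e₁) 0≤⅛) step₃) (≤-trans 1+ε≤r₁ (<⇒≤ r₁<a₂)) step₃) (<⇒≤ p₂<a₁)

theorem1 : ∀ (ε : ℚ) → 0ℚ < ε →
    ∃[ N ] (∀ (n : ℕ) → 1 ℕ.≤ n → N ℕ.≤ n →
    q n ≤ʳ fromℚ (1ℚ + ε) *ʳ (e *ʳ ln (+ 2 / 1) *ʳ fromℚ (+ 1 / 8)) *ʳ fromℕ (n ℕ.^ 2))
theorem1 ε 0<ε =
  let (1/ε , 0<1/ε , ε/ε≡1) = inverse 0<ε
      (N₀ , 40/ε≤N₀) = archimedean (ι 40 * 1/ε)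
  -- The threshold depends on `ε` alone: `N₀` is at least 40/ε, and 4 ≤ n serves the crude bound h ≤
  -- n².
  in 4 ℕ.+ N₀ , λ n _ N≤n s above →
    let (e₁ , l , partial , 0≤l , 2≤exp , bound<s) = product-cut {n = n} 0<ε above
        (g , 1≤g , n²≤4g , 4g≤n²+4) = quarter (n ℕ.* n)
        4≤n = ℕₚ.≤-trans (ℕₚ.m≤m+n 4 N₀) N≤n
        (H , ¬col , smallest , light) = light-obstruction partial 0≤l 2≤exp g n (ℕₚ.≤-trans (s≤s (s≤s z≤n)) 4≤n) 1≤g n²≤4g
        ½≤c = begin
          ½          ≤⟨ ½≤ln2 0≤l 2≤exp ⟩
          l          ≡⟨ *-identityʳ l ⟨
          l * 1ℚ     ≤⟨ *-monoʳ l 0≤l (1≤e₁ partial) ⟩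
          l * e₁     ∎
        40≤εn = begin
          ι 40                  ≡⟨ *-identityʳ (ι 40) ⟨
          ι 40 * 1ℚ             ≡⟨ cong (λ z → ι 40 * z) ε/ε≡1 ⟨
          ι 40 * (ε * 1/ε)
            ≡⟨ solve 3 (λ a e r → a :* (e :* r) := e :* (a :* r)) refl (ι 40) ε 1/ε ⟩
          ε * (ι 40 * 1/ε)
            ≤⟨ *-monoʳ ε (<⇒≤ 0<ε) (≤-trans 40/ε≤N₀ (ι-mono (ℕₚ.≤-trans (ℕₚ.m≤n+m N₀ 4) N≤n))) ⟩
          ε * ι n               ∎
        4h≤ = ℕₚ.≤-trans (ℕₚ.≤-reflexive (ℕₚ.*-distribˡ-+ 4 g n)) (ℕₚ.+-monoˡ-≤ (4 ℕ.* n) 4g≤n²+4)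
    -- The weight of `H` is itself an attained value below `s`, which is all that the infimum asks
    -- for.
    in weight H , 0≤edgeWeight (edges H) , (H , ¬col , smallest , refl) ,
       ≤-<-trans (≤-trans light (weight-estimate {ε} ½≤c {h = g ℕ.+ n} 4≤n 40≤εn 4h≤)) bound<s
  where open ≤-Reasoning
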